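{- Let $\mathcal{S}=(X,\xrightarrow{\Sigma},\le)$ be a very-WSTS and $I\in\mathrm{Idl}(X)$. Then $$D_I=\downarrow\mathrm{Post}^*(I),\qquad \mathrm{Traces}(\mathcal{S},I)\subseteq L(\mathcal{A}_I),\qquad L(\mathcal{K}_I)\subseteq \downarrow_{\preceq}\mathrm{Traces}(\mathcal{S},I).$$ In particular, for every $x\in X$, $D_{\downarrow x}=\downarrow\mathrm{Post}^*(x)$, $\downarrow_\preceq L(\mathcal{K}_{\downarrow x})=\downarrow_\preceq\mathrm{Traces}(\mathcal{S},x)$, and $\downarrow_\preceq\mathrm{Traces}(\mathcal{S},x)$ is a computable regular language.
   Context: A (labeled, ordered) transition system is a triple $\mathcal{S}=(X,\xrightarrow{\Sigma},\le)$ where $X$ is a set, $\Sigma$ a finite alphabet, $\xrightarrow{a}\subseteq X\times X$ a relation for each $a\in\Sigma$, and $\le$ a quasi-ordering on $X$. Relations are extended to words: $x\xrightarrow{\varepsilon}x$, and $x\xrightarrow{wa}y$ iff $x\xrightarrow{w}x'\xrightarrow{a}y$ for some $x'$. $\mathrm{Post}(x,w)=\{y: x\xrightarrow{w}y\}$, $\mathrm{Post}^*(x)=\{y: x\xrightarrow{w}y \text{ for some } w\in\Sigma^*\}$, both extended to sets by union. $\downarrow D=\{x: x\le y \text{ for some } y\in D\}$. $\mathrm{Traces}(\mathcal{S},x)=\{w\in\Sigma^*: x\xrightarrow{w}y \text{ for some } y\}$ and $\mathrm{Traces}(\mathcal{S},I)=\bigcup_{x\in I}\mathrm{Traces}(\mathcal{S},x)$.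 $u\preceq v$ means $u$ is a (scattered) subword of $v$, and $\downarrow_\preceq L=\{u: u\preceq v \text{ for some } v\in L\}$. $\mathcal{S}$ is a WSTS if $\le$ is a wqo and $\mathcal{S}$ is monotone: $x\xrightarrow{a}y$, $x'\ge x$ imply $x'\xrightarrow{w}y'$ for some $w\in\Sigma^*$, $y'\ge y$. Strong monotonicity: $x\xrightarrow{a}y$, $x'\ge x$ imply $x'\xrightarrow{a}y'$ for some $y'\ge y$; strong-strict monotonicity: in addition $x'>x$ implies such a $y'>y$ exists. Deterministic: $|\mathrm{Post}(x,a)|\le 1$. An ideal of $X$ is a nonempty downward-closed directed subset; $\mathrm{Idl}(X)$ is the set of ideals. For a downward-closed $D$ in a wqo, $\mathrm{IdealDecomp}(D)$ is the finite set of $\subseteq$-maximal ideals contained in $D$. The completion is $\widehat{\mathcal{S}}=(\mathrm{Idl}(X),\Rightarrow_\Sigma,\subseteq)$ with $I\xRightarrow{a}J$ iff $J\in\mathrm{IdealDecomp}(\downarrow\mathrm{Post}(I,a))$, extended to words. When $\widehat{\mathcal{S}}$ is deterministic, $w(I)$ is the unique $J$ with $I\xRightarrow{w}J$, if defined. A strictly increasing sequence of ideals is an acceleration candidate; $\mathrm{Idl}_0(X)=\mathrm{Idl}(X)$, $\mathrm{Idl}_n(X)=\{\bigcup_iI_i: (I_i) \text{ acceleration candidate in } \mathrm{Idl}_{n-1}(X)\}$; finitely many levels means $\mathrm{Idl}_n(X)=\emptyset$ for some $n$. For $w\in\Sigma^+$: $w^\infty(I)=\bigcup_k w^k(I)$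 if $I\subset w(I)$, else $I$. A very-WSTS is a WSTS with strong monotonicity whose completion is a deterministic WSTS ($\subseteq$ a wqo on $\mathrm{Idl}(X)$, $\widehat{\mathcal{S}}$ monotone) with strong-strict monotonicity, and such that $\mathrm{Idl}(X)$ has finitely many levels. Ideal Karp-Miller algorithm on input $(\mathcal{S},I_0)$ (it terminates on very-WSTS): builds a rooted tree with node labels $(\mathrm{ideal}(c),\mathrm{numaccel}(c))$ and letter-labeled arcs. Start with root $r$ labeled $(I_0,0)$. While there is an unmarked node $c$ labeled $(I,n)$: if a proper ancestor $c'$ has $\mathrm{ideal}(c')=I$, mark $c$. Otherwise: if a proper ancestor $c'$ has $\mathrm{ideal}(c')\subset I$ and $\mathrm{numaccel}(c')=n$, let $w$ be the arc-label word from $c'$ to $c$ and relabel $c$ by $(w^\infty(I),n+1)$ ($c$ is then said to be accelerated because of $c'$); then, with $(I,n)$ the current label of $c$, for each $a\in\Sigma$ with $a(I)$ defined add a child $d$ labeled $(a(I),n)$ via an arc labeled $a$; mark $c$. $\mathcal{T}_I$ denotes the returned tree on input $(\mathcal{S},I)$, and $D_I=\bigcup_{c\in\mathcal{T}_I}\mathrm{ideal}(c)$. The stuttering automaton $\mathcal{A}_I$ is the finite word automaton whose states are the nodes of $\mathcal{T}_I$, all accepting, with initial state the root, whose transitions are the arcs of $\mathcal{T}_I$ plus an $\varepsilon$-transition from each leaf $c$ to any ancestor $c'$ with $\mathrm{ideal}(c)=\mathrm{ideal}(c')$. The Karp-Miller automaton $\mathcal{K}_I$ is $\mathcal{A}_I$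 extended with an $\varepsilon$-transition from each node $c$ that was accelerated because of an ancestor $c'$ to $c'$. $L(\cdot)$ denotes the accepted language over $\Sigma$. -}

module Defs where

open import Axiom.ExcludedMiddle using (ExcludedMiddle) public
open import Data.Bool using (Bool; true; false; T; if_then_else_)
open import Data.Fin using (Fin; _≟_)
open import Data.List using (List; []; _∷_; _++_; [_]; concat; replicate)
open import Data.List.Relation.Binary.Sublist.Propositional using () renaming (_⊆_ to _≼_) public
open import Data.Maybe using (Maybe; just; nothing)
import Data.Maybe as Maybe
open import Data.Nat using (ℕ; zero; suc; _<_)
open import Data.Product using (Σ; ∃; _×_; _,_; proj₁; proj₂)
open import Data.Sum using (_⊎_)
open import Data.Unit.Polymorphic using (⊤)
open import Function using (id; _∘_)
open import Level using (Level; _⊔_; 0ℓ) renaming (suc to lsuc)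
open import Relation.Binary using (Rel; IsPreorder)
open import Relation.Binary.PropositionalEquality using (_≡_; refl; isEquivalence)
open import Relation.Nullary using (¬_; Dec; does)
open import Relation.Unary using (Pred; _∈_; _⊆_; _⊂_; _≐_; Satisfiable; ⋃)

private variable
  ℓ ℓ₁ ℓ₂ x r o : Level
  A : Set ℓ
  k : ℕ

-- The alphabet with k letters is Fin k.
Word : ℕ → Set
Word k = List (Fin k)

Language : ℕ → (ℓ : Level) → Set (lsuc ℓ)
Language k ℓ = Pred (Word k) ℓ

↓≼ : Language k ℓ → Language k ℓ
↓≼ L u = ∃ λ v → u ≼ v × v ∈ L

record TransitionSystem (k : ℕ) (x r o : Level) : Set (lsuc (x ⊔ r ⊔ o)) where
  infix 4 _⟶[_]_ _≤_
  field
    Carrier      : Set x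
    _⟶[_]_       : Carrier → Fin k → Carrier → Set r
    _≤_          : Rel Carrier o
    isQuasiOrder : IsPreorder _≡_ _≤_

open TransitionSystem using (Carrier)

module _ (S : TransitionSystem k x r o) where
  open TransitionSystem S using (_⟶[_]_; _≤_)
  private X = Carrier S

  data Path : X → Word k → X → Set (x ⊔ r) where
    []  : ∀ {p} → Path p [] p
    _∷_ : ∀ {p q s a w} → p ⟶[ a ] q → Path q w s → Path p (a ∷ w) s

  Post : Pred X ℓ → Fin k → Pred X (x ⊔ r ⊔ ℓ)
  Post D a q = ∃ λ p → p ∈ D × p ⟶[ a ] q

  Post* : X → Pred X (x ⊔ r)
  Post* p q = ∃ λ w → Path p w q

  Post*ˢ : Pred X ℓ → Pred X (x ⊔ r ⊔ ℓ)
  Post*ˢ D q = ∃ λ p → p ∈ D × q ∈ Post* p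

  ↓ : Pred X ℓ → Pred X (x ⊔ o ⊔ ℓ)
  ↓ D p = ∃ λ q → p ≤ q × q ∈ D

  Traces : X → Language k (x ⊔ r)
  Traces p w = ∃ λ q → Path p w q

  Tracesˢ : Pred X ℓ → Language k (x ⊔ r ⊔ ℓ)
  Tracesˢ D w = ∃ λ p → p ∈ D × w ∈ Traces p

  StrictlyBelow : Rel X o
  StrictlyBelow p q = p ≤ q × ¬ (q ≤ p)

  Wqo : Set (x ⊔ o)
  Wqo = ∀ (f : ℕ → X) → ∃ λ i → ∃ λ j → i < j × f i ≤ f j

  Monotone : Set (x ⊔ r ⊔ o)
  Monotone = ∀ {p q p′ a} → p ⟶[ a ] q → p ≤ p′ →
             ∃ λ w → ∃ λ q′ → Path p′ w q′ × q ≤ q′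

  StronglyMonotone : Set (x ⊔ r ⊔ o)
  StronglyMonotone = ∀ {p q p′ a} → p ⟶[ a ] q → p ≤ p′ →
                     ∃ λ q′ → p′ ⟶[ a ] q′ × q ≤ q′

  StrongStrictlyMonotone : Set (x ⊔ r ⊔ o)
  StrongStrictlyMonotone = StronglyMonotone ×
    (∀ {p q p′ a} → p ⟶[ a ] q → StrictlyBelow p p′ →
       ∃ λ q′ → p′ ⟶[ a ] q′ × StrictlyBelow q q′)

  -- The equality on states is a parameter because ideals, being predicates,
  -- are to be compared extensionally.
  Deterministic : Rel X ℓ → Set (x ⊔ r ⊔ ℓ)
  Deterministic _≈_ = ∀ {p q q′ a} → p ⟶[ a ] q → p ⟶[ a ] q′ → q ≈ q′

  record IsWSTS : Set (x ⊔ r ⊔ o) where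
    field
      wqo      : Wqo
      monotone : Monotone

module _ (S : TransitionSystem k 0ℓ 0ℓ 0ℓ) where
  open TransitionSystem S using (_≤_; isQuasiOrder)
  private
    X = Carrier S
    module ≤ = IsPreorder isQuasiOrder

  record Ideal : Set₁ where
    field
      set        : Pred X 0ℓ
      nonempty   : Satisfiable set
      downClosed : ∀ {p q} → p ≤ q → q ∈ set → p ∈ set
      directed   : ∀ {p q} → p ∈ set → q ∈ set → ∃ λ s → s ∈ set × p ≤ s × q ≤ s

  open Ideal using (set)

  principal : X → Ideal
  principal p = record
    { set        = λ q → q ≤ p
    ; nonempty   = p , ≤.refl
    ; downClosed = ≤.trans
    ; directed   = λ s≤p t≤p → p , ≤.refl , s≤p , t≤p
    }

  IdealDecomp : Pred X ℓ → Pred Ideal (lsuc 0ℓ ⊔ ℓ)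
  IdealDecomp D J = set J ⊆ D × (∀ K → set K ⊆ D → set J ⊆ set K → set K ⊆ set J)

  completion : TransitionSystem k (lsuc 0ℓ) (lsuc 0ℓ) 0ℓ
  completion = record
    { Carrier      = Ideal
    ; _⟶[_]_       = λ I a J → J ∈ IdealDecomp (↓ S (Post S (set I) a))
    ; _≤_          = λ I J → set I ⊆ set J
    ; isQuasiOrder = record
      { isEquivalence = isEquivalence
      ; reflexive     = λ { refl → id }
      ; trans         = λ I⊆J J⊆K → J⊆K ∘ I⊆J
      }
    }

  open TransitionSystem completion using () renaming (_⟶[_]_ to _⟹[_]_)

  AccelerationCandidate : (ℕ → Ideal) → Set
  AccelerationCandidate f = ∀ i → set (f i) ⊂ set (f (suc i))

  Idl : ℕ → Pred Ideal (lsuc 0ℓ)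
  Idl zero    I = ⊤
  Idl (suc n) I = ∃ λ (f : ℕ → Ideal) →
    AccelerationCandidate f × (∀ i → f i ∈ Idl n) × set I ≐ ⋃ ℕ (set ∘ f)

  FinitelyManyLevels : Set₁
  FinitelyManyLevels = ∃ λ n → ∀ I → ¬ (I ∈ Idl n)

  record IsVeryWSTS : Set₁ where
    field
      isWSTS                   : IsWSTS S
      stronglyMonotone         : StronglyMonotone S
      completionDeterministic  : Deterministic completion (λ I J → set I ≐ set J)
      completionIsWSTS         : IsWSTS completion
      completionStrongStrict   : StrongStrictlyMonotone completion
      finitelyManyLevels       : FinitelyManyLevels

  -- I ⊂ w(I); in particular w(I) is defined.
  Grows : Word k → Ideal → Set₁
  Grows w I = ∃ λ J → Path completion I w J × set I ⊂ set J

  iterates : Word k → Ideal → Pred X (lsuc 0ℓ)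
  iterates w I p = ∃ λ n → ∃ λ J → Path completion I (concat (replicate n w)) J × p ∈ set J

  -- J = w^∞(I)
  Acceleration : Word k → Ideal → Ideal → Set₁
  Acceleration w I J = (Grows w I × set J ≐ iterates w I) ⊎ (¬ Grows w I × set J ≐ set I)

  -- "cause" is just w when the node has been accelerated because of its
  -- ancestor c′, where w is the word read from c′ down to the node.
  record Tree : Set₁ where
    inductive
    constructor node
    field
      ideal    : Ideal
      numaccel : ℕ
      marked   : Bool
      cause    : Maybe (Word k)
      child    : Fin k → Maybe Tree

  fresh : Ideal → ℕ → Tree
  fresh I n = node I n false nothing (λ _ → nothing)

  infix 5 _‼_
  _‼_ : Tree → Word k → Maybe Tree
  t ‼ []      = just t
  t ‼ (a ∷ u) = Tree.child t a Maybe.>>= _‼ u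

  replaceAt : Word k → Tree → Tree → Tree
  replaceAt []      new t = new
  replaceAt (a ∷ u) new t = record t
    { child = λ b → if does (a ≟ b) then Maybe.map (replaceAt u new) (Tree.child t b)
                                    else Tree.child t b }

  -- A node is identified by the word labeling the path to it from the root.
  record Node (t : Tree) : Set₁ where
    field
      address : Word k
      subtree : Tree
      located : t ‼ address ≡ just subtree
    open Tree subtree public

  open Node

  module _ {t : Tree} where

    -- The word w labels the path from the ancestor c′ down to c.
    Descends : Node t → Word k → Node t → Set
    Descends c′ w c = address c′ ++ w ≡ address c

    Repeats : Node t → Node t → Set
    Repeats c′ c = (∃ λ w → ¬ (w ≡ []) × Descends c′ w c) × set (ideal c′) ≐ set (ideal c)

    Dominates : Node t → Word k → Node t → Set
    Dominates c′ w c = ¬ (w ≡ []) × Descends c′ w c ×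
                       set (ideal c′) ⊂ set (ideal c) × numaccel c′ ≡ numaccel c

    Leaf : Node t → Set₁
    Leaf c = ∀ a → child c a ≡ nothing

  Children : Ideal → ℕ → (Fin k → Maybe Tree) → Set₁
  Children I n kids = ∀ a →
    (∃ λ J → I ⟹[ a ] J × kids a ≡ just (fresh J n)) ⊎
    ((∀ J → ¬ (I ⟹[ a ] J)) × kids a ≡ nothing)

  -- Processing the unmarked node c turns the subtree at c into the given tree.
  data Process {t : Tree} (c : Node t) : Tree → Set₁ where
    close : ∀ c′ → Repeats c′ c →
            Process c (record (subtree c) { marked = true })
    accelerate : ∀ {J kids} → (∀ c′ → ¬ Repeats c′ c) →
                 ∀ c′ w → Dominates c′ w c →
                 Acceleration w (ideal c) J →
                 Children J (suc (numaccel c)) kids →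
                 Process c (node J (suc (numaccel c)) true (just w) kids)
    expand : ∀ {kids} → (∀ c′ → ¬ Repeats c′ c) →
             (∀ c′ w → ¬ Dominates c′ w c) →
             Children (ideal c) (numaccel c) kids →
             Process c (node (ideal c) (numaccel c) true nothing kids)

  data Reachable (I : Ideal) : Tree → Set₁ where
    start : Reachable I (fresh I 0)
    step  : ∀ {t} → Reachable I t →
            (c : Node t) → marked c ≡ false →
            ∀ {new} → Process c new → Reachable I (replaceAt (address c) new t)

  -- The algorithm may pick any suitable ancestor when accelerating, so the
  -- output is a relation: t is a possible value of 𝒯_I.
  Returns : Ideal → Tree → Set₁
  Returns I t = Reachable I t × (∀ (c : Node t) → marked c ≡ true)

  D : Tree → Pred X (lsuc 0ℓ)
  D t p = ∃ λ (c : Node t) → p ∈ set (ideal c)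

record Automaton (k : ℕ) (ℓ₁ ℓ₂ : Level) : Set (lsuc (ℓ₁ ⊔ ℓ₂)) where
  field
    State     : Set ℓ₁
    initial   : State
    accepting : Pred State ℓ₂
    -- A transition labeled nothing is an ε-transition.
    move      : State → Maybe (Fin k) → State → Set ℓ₂

module _ (M : Automaton k ℓ₁ ℓ₂) where
  open Automaton M

  data Run : State → Word k → State → Set (ℓ₁ ⊔ ℓ₂) where
    done   : ∀ {p} → Run p [] p
    read   : ∀ {p q s a w} → move p (just a) q → Run q w s → Run p (a ∷ w) s
    silent : ∀ {p q s w} → move p nothing q → Run q w s → Run p w s

  L : Language k (ℓ₁ ⊔ ℓ₂)
  L w = ∃ λ q → Run initial w q × q ∈ accepting

record FiniteAutomaton (k : ℕ) : Set where
  field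
    size      : ℕ
    initial   : Fin size
    accepting : Fin size → Bool
    move      : Fin size → Maybe (Fin k) → Fin size → Bool

automaton : FiniteAutomaton k → Automaton k 0ℓ 0ℓ
automaton F = record
  { State     = Fin size
  ; initial   = initial
  ; accepting = T ∘ accepting
  ; move      = λ p α q → T (move p α q)
  }
  where open FiniteAutomaton F

_Recognizes_ : FiniteAutomaton k → Language k ℓ → Set ℓ
F Recognizes M = L (automaton F) ≐ M

Regular : Language k ℓ → Set ℓ
Regular M = ∃ λ F → F Recognizes M

module _ (S : TransitionSystem k 0ℓ 0ℓ 0ℓ) (t : Tree S) where
  open Node
  open Ideal using (set)

  root : Node S t
  root = record { address = [] ; subtree = t ; located = refl }

  data StutteringMove : Node S t → Maybe (Fin k) → Node S t → Set₁ where
    arc  : ∀ {c d a} → Descends S c [ a ] d → StutteringMove c (just a) d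
    loop : ∀ {c c′ w} → Leaf S c → Descends S c′ w c →
           set (ideal c) ≐ set (ideal c′) → StutteringMove c nothing c′

  data KarpMillerMove : Node S t → Maybe (Fin k) → Node S t → Set₁ where
    stuttering : ∀ {c α d} → StutteringMove c α d → KarpMillerMove c α d
    back       : ∀ {c c′ w} → cause c ≡ just w → Descends S c′ w c →
                 KarpMillerMove c nothing c′

  𝒜 : Automaton k (lsuc 0ℓ) (lsuc 0ℓ)
  𝒜 = record { State = Node S t ; initial = root ; accepting = λ _ → ⊤ ; move = StutteringMove }

  𝒦 : Automaton k (lsuc 0ℓ) (lsuc 0ℓ)
  𝒦 = record { State = Node S t ; initial = root ; accepting = λ _ → ⊤ ; move = KarpMillerMove }

-- A possibly nonterminating computation, given by its result after each
-- amount of fuel.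
Computation : Set ℓ → Set ℓ
Computation A = ℕ → Maybe A

-- The computation terminates, and whatever it outputs satisfies P.
_Computes_ : Computation A → Pred A ℓ → Set _
f Computes P = (∃ λ n → ∃ λ a → f n ≡ just a) × (∀ n a → f n ≡ just a → P a)

-- The primitives that the algorithm needs, on representations of ideals.
record Effective (S : TransitionSystem k 0ℓ 0ℓ 0ℓ) : Set₁ where
  open TransitionSystem (completion S) using () renaming (_⟶[_]_ to _⟹[_]_)
  open Ideal using (set)
  field
    Code       : Set
    ⟦_⟧        : Code → Ideal S
    down       : ∀ p → ∃ λ c → set ⟦ c ⟧ ≐ set (principal S p)
    inclusion? : ∀ c d → Dec (set ⟦ c ⟧ ⊆ set ⟦ d ⟧)
    successor  : ∀ c a → (∃ λ d → ⟦ c ⟧ ⟹[ a ] ⟦ d ⟧) ⊎ (∀ J → ¬ (⟦ c ⟧ ⟹[ a ] J))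
    -- computes (a ∷ w)^∞
    power      : ∀ a w c → ∃ λ d → Acceleration S (a ∷ w) ⟦ c ⟧ ⟦ d ⟧

{-# OPTIONS --safe #-}
module Submission where

-- In a wqo every downward-closed set is a finite union of ideals, so determinism of the
-- completion makes a(I) equal to ↓Post(I, a) whenever the latter is nonempty. The ideal of a
-- node reached by u is therefore contained in the downward closure of what I reaches by the
-- words above u: an acceleration w^∞ only inserts further copies of w, and an ε-transition
-- leads to an included ideal. Conversely, a step of the system from a state in the ideal of a
-- node is followed by an arc, possibly after the ε-transition that leaves a repeating leaf.
--
-- For termination, Idl_n is closed under successors, and an accelerated ideal of Idl_n lies in
-- Idl_{n+1}, so the acceleration count is bounded and eventually constant along an infinite
-- branch; there the wqo on ideals yields a repetition or one more acceleration.
--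
-- The procedure runs the algorithm on codes of ideals with a bound on the depth, and turns the
-- resulting tree into a finite automaton. Classically every system is effective, with terms as
-- codes, which gives the existence of the tree and regularity.

open import Defs
open import Axiom.DoubleNegationElimination using (em⇒dne)
open import Data.Bool using (true; false; if_then_else_)
open import Data.Empty using (⊥; ⊥-elim)
open import Data.Fin using (Fin; _≟_)
import Data.Fin.Properties as Fin
open import Data.List using
  (List; []; _∷_; [_]; _++_; allFin; concat; concatMap; fromMaybe; length; lookup; map; replicate)
open import Data.List.Membership.Propositional using (find; lose) renaming (_∈_ to _∈ˡ_)
open import Data.List.Membership.Propositional.Properties using (∈-allFin; ∈-map⁺; ∈-map⁻)
open import Data.List.Properties using (++-identityʳ; ++-assoc; ++-cancelʳ; ∷-injective; map-∘; ≡-dec)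
open import Data.List.Relation.Binary.Sublist.Propositional
  using ([]; _∷_; _∷ʳ_; ⊆-refl; ⊆-trans; minimum)
open import Data.List.Relation.Binary.Sublist.Propositional.Properties using (++⁺)
open import Data.List.Relation.Unary.All using (All; []; _∷_)
import Data.List.Relation.Unary.All as All
import Data.List.Relation.Unary.All.Properties as All
open import Data.List.Relation.Unary.Any using (Any; here; there)
import Data.List.Relation.Unary.Any as Any
import Data.List.Relation.Unary.Any.Properties as Any
open import Data.Maybe using (Maybe; just; nothing; Is-just; to-witness)
import Data.Maybe as Maybe
open import Data.Maybe.Properties using (just-injective)
open import Data.Maybe.Relation.Unary.Any using (just)
open import Data.Nat using (ℕ; zero; suc; _+_; _<_; _⊔_; s≤s; _≤′_; ≤′-refl; ≤′-step)
import Data.Nat as ℕ using (_≤_; _≟_)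
import Data.Nat.Properties as ℕ
open import Data.Product using (Σ; ∃; _×_; _,_; proj₁; proj₂)
open import Data.Sum using (_⊎_; inj₁; inj₂)
import Data.Sum as Sum
open import Data.Unit.Polymorphic using (tt)
import Data.Unit as Unit
open import Function using (id; _∘_; case_of_)
open import Induction.WellFounded using (Acc; acc)
open import Level using (lift; lower; 0ℓ) renaming (suc to lsuc; _⊔_ to _ℓ⊔_)
open import Relation.Binary using (IsPreorder)
open import Relation.Binary.PropositionalEquality using (_≡_; refl; sym; trans; cong; subst)
open import Relation.Nullary using (¬_; Dec; yes; no; contradiction)
open import Relation.Nullary.Decidable
  using (map′; toWitness; fromWitness; ⌊_⌋; _×-dec_; _⊎-dec_; ¬?)
open import Relation.Unary using (Pred; _∈_; _∉_; _⊆_; _⊂_; _≐_; Satisfiable; ⋃)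
open import Relation.Unary.Properties using (≐-trans)

-- Well-quasi-orders and ideal decompositions

lowerEM : ExcludedMiddle (lsuc 0ℓ) → ExcludedMiddle 0ℓ
lowerEM em = map′ lower lift em

module _ {a r} {A : Set a} {_◁_ : A → A → Set r} (em : ExcludedMiddle (a ℓ⊔ r)) where

  private
    descend : (∃ λ x → ¬ Acc _◁_ x) → ∃ λ x → ¬ Acc _◁_ x
    inaccessible-child : ∀ {x} → ¬ Acc _◁_ x → ∃ λ y → y ◁ x × ¬ Acc _◁_ y
    inaccessible-child ¬acc = em⇒dne em λ none → ¬acc (acc λ {y} y◁x →
      em⇒dne em λ ¬accy → none (y , y◁x , ¬accy))
    descend (x , ¬acc) = let y , _ , ¬accy = inaccessible-child ¬acc in y , ¬accy

    descent : ∀ {x} → ¬ Acc _◁_ x → ℕ → ∃ λ y → ¬ Acc _◁_ y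
    descent {x} ¬acc zero    = x , ¬acc
    descent ¬acc (suc i) = descend (descent ¬acc i)

  -- An inaccessible point has an inaccessible child, and iterating this choice yields an infinite
  -- descent. The condition `f 0 ≡ x` lets an invariant of the starting point be carried along the
  -- sequence.
  noDescent⇒acc : ∀ x → (∀ (f : ℕ → A) → f 0 ≡ x → ¬ (∀ i → f (suc i) ◁ f i)) → Acc _◁_ x
  noDescent⇒acc x none = em⇒dne em λ ¬acc → none (proj₁ ∘ descent ¬acc) refl
    λ i → proj₁ (proj₂ (inaccessible-child (proj₂ (descent ¬acc i))))

module _ {k x r o} (T : TransitionSystem k x r o) where
  open TransitionSystem T using (_≤_)

  path-++ : ∀ {p q s u v} → Path T p u q → Path T q v s → Path T p (u ++ v) s
  path-++ []       π = π
  path-++ (e ∷ es) π = e ∷ path-++ es π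

  path-strict : StrongStrictlyMonotone T → ∀ {p q p′ w} → Path T p w q → StrictlyBelow T p p′ →
                ∃ λ q′ → Path T p′ w q′ × StrictlyBelow T q q′
  path-strict mono []       p<p′ = _ , [] , p<p′
  path-strict mono (e ∷ es) p<p′ =
    let _ , e′ , q<q′   = proj₂ mono e p<p′
        _ , es′ , s<s′ = path-strict mono es q<q′
    in _ , e′ ∷ es′ , s<s′

  path-mono : StronglyMonotone T → ∀ {p q p′ w} → Path T p w q → p ≤ p′ →
              ∃ λ q′ → Path T p′ w q′ × q ≤ q′
  path-mono mono []       p≤p′ = _ , [] , p≤p′
  path-mono mono (e ∷ es) p≤p′ =
    let _ , e′ , q≤q′   = mono e p≤p′
        _ , es′ , s≤s′ = path-mono mono es q≤q′
    in _ , e′ ∷ es′ , s≤s′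

module _ {k} (S : TransitionSystem k 0ℓ 0ℓ 0ℓ) where
  open TransitionSystem S using (_⟶[_]_; isQuasiOrder) renaming (Carrier to X; _≤_ to _⊑_)
  open TransitionSystem (completion S) using () renaming (_⟶[_]_ to _⟹[_]_)
  open Ideal
  private module ≤ = IsPreorder isQuasiOrder

  DownClosed : Set₁
  DownClosed = Σ (Pred X 0ℓ) λ D → ∀ {p q} → p ⊑ q → q ∈ D → p ∈ D

  ↓-closed : Pred X 0ℓ → DownClosed
  ↓-closed D = ↓ S D , λ { p≤q (s , q≤s , s∈D) → s , ≤.trans p≤q q≤s , s∈D }

  _⊊_ : DownClosed → DownClosed → Set
  D ⊊ E = proj₁ D ⊂ proj₁ E

  module _ (em : ExcludedMiddle (lsuc 0ℓ)) (wqo : Wqo S) where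
    private
      em₀ : ExcludedMiddle 0ℓ
      em₀ = lowerEM em

      antitone : ∀ (f : ℕ → DownClosed) → (∀ i → f (suc i) ⊊ f i) →
                 ∀ {i j} → i ≤′ j → proj₁ (f j) ⊆ proj₁ (f i)
      antitone f f↓ ≤′-refl           = id
      antitone f f↓ (≤′-step {n} i≤n) = antitone f f↓ i≤n ∘ proj₁ (f↓ n)

    -- Each step of a strictly descending sequence loses some point. If the point lost at i lies
    -- below the one lost at a later j, the latter still belongs to `f (suc i)`, and downward
    -- closure puts the former there too.
    ⊊-acc : ∀ D → Acc _⊊_ D
    ⊊-acc D = noDescent⇒acc em D λ f _ f↓ →
      let lost : ∀ i → ∃ λ p → p ∈ proj₁ (f i) × p ∉ proj₁ (f (suc i))
          lost i = em⇒dne em₀ λ none → proj₂ (f↓ i) λ {p} p∈fi →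
            em⇒dne em₀ λ p∉ → none (p , p∈fi , p∉)
          i , j , i<j , pᵢ≤pⱼ = wqo (proj₁ ∘ lost)
      in proj₂ (proj₂ (lost i))
           (proj₂ (f (suc i)) pᵢ≤pⱼ (antitone f f↓ (ℕ.≤⇒≤′ i<j) (proj₁ (proj₂ (lost j)))))

    Directed : Pred X 0ℓ → Set
    Directed D = ∀ {p q} → p ∈ D → q ∈ D → ∃ λ s → s ∈ D × p ⊑ s × q ⊑ s

    ⋃ˡ : List (Ideal S) → Pred X (lsuc 0ℓ)
    ⋃ˡ Js p = Any (λ J → p ∈ set J) Js

    -- If p and q have no common upper bound in D, then D is the union of the
    -- smaller sets D ∖ ↑p and D ∖ ↑q.
    decompose : ∀ D → Acc _⊊_ D →
                ∃ λ Js → All (λ J → set J ⊆ proj₁ D) Js × proj₁ D ⊆ ⋃ˡ Js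
    decompose (D , closed) (acc rs) with em₀ {Satisfiable D} | em₀ {Directed D}
    ... | no ¬∃   | _       = [] , [] , λ {p} p∈D → contradiction (p , p∈D) ¬∃
    ... | yes ∃p  | yes dir =
      record { set = D ; nonempty = ∃p ; downClosed = closed ; directed = dir } ∷ [] ,
      id ∷ [] , here
    ... | yes _   | no ¬dir =
      let p , q , p∈D , q∈D , unbounded = counterexample
          Js , Js⊆ , ⊆Js = decompose (D ∖↑ p) (rs (proj₁ , λ D⊆ → proj₂ (D⊆ p∈D) ≤.refl))
          Ks , Ks⊆ , ⊆Ks = decompose (D ∖↑ q) (rs (proj₁ , λ D⊆ → proj₂ (D⊆ q∈D) ≤.refl))
      in Js ++ Ks ,
         All.++⁺ (weaken p Js⊆) (weaken q Ks⊆) ,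
         λ {s} s∈D → case em₀ {p ⊑ s} of λ
           { (no  p≰s) → Any.++⁺ˡ (⊆Js (s∈D , p≰s))
           ; (yes p≤s) → Any.++⁺ʳ Js (⊆Ks (s∈D , unbounded s s∈D p≤s)) }
      where
      _∖↑_ : Pred X 0ℓ → X → DownClosed
      _ ∖↑ p = (λ s → s ∈ D × ¬ (p ⊑ s)) ,
               λ { s≤t (t∈D , p≰t) → closed s≤t t∈D , λ p≤s → p≰t (≤.trans p≤s s≤t) }
      weaken : ∀ p {Js} → All (λ J → set J ⊆ proj₁ (D ∖↑ p)) Js → All (λ J → set J ⊆ D) Js
      weaken p []         = []
      weaken p (J⊆ ∷ Js⊆) = proj₁ ∘ J⊆ ∷ weaken p Js⊆
      counterexample : ∃ λ p → ∃ λ q → p ∈ D × q ∈ D × (∀ s → s ∈ D → p ⊑ s → ¬ (q ⊑ s))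
      counterexample = em⇒dne em₀ λ none → ¬dir λ {p} {q} p∈D q∈D → em⇒dne em₀ λ unb →
        none (p , q , p∈D , q∈D , λ s s∈D p≤s q≤s → unb (s , s∈D , p≤s , q≤s))

    -- If K is not inside J, fix p in K outside J. By directedness each q in K lies below some s in
    -- K that is also above p; this s avoids J, so it is covered by the remaining ideals, and q with
    -- it.
    ideal-prime : ∀ Js (K : Ideal S) → set K ⊆ ⋃ˡ Js → Any (λ J → set K ⊆ set J) Js
    ideal-prime []       K K⊆ with K⊆ (proj₂ (nonempty K))
    ... | ()
    ideal-prime (J ∷ Js) K K⊆ with em₀ {set K ⊆ set J}
    ... | yes K⊆J = here K⊆J
    ... | no  K⊈J = there (ideal-prime Js K λ q∈K →
      let p , p∈K , p∉J = em⇒dne em₀ λ none → K⊈J λ {p} p∈K →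
            em⇒dne em₀ λ p∉J → none (p , p∈K , p∉J)
          s , s∈K , p≤s , q≤s = directed K p∈K q∈K
      in case K⊆ s∈K of λ
        { (here s∈J)   → contradiction (downClosed J p≤s s∈J) p∉J
        ; (there s∈Js) → Any.map (λ {J′} → downClosed J′ q≤s) s∈Js })

    -- One pass through the list suffices: an ideal skipped for not containing the current one
    -- contains none of the later, larger ones.
    maximal-above : ∀ {P : Pred (Ideal S) 0ℓ} Js → All P Js → ∀ J → P J →
      ∃ λ J′ → P J′ × set J ⊆ set J′ × All (λ K → set J′ ⊆ set K → set K ⊆ set J′) Js
    maximal-above []       []         J PJ = J , PJ , id , []
    maximal-above (K ∷ Js) (PK ∷ PJs) J PJ with em₀ {set J ⊆ set K}
    ... | yes J⊆K =
      let J′ , PJ′ , K⊆J′ , max = maximal-above Js PJs K PK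
      in J′ , PJ′ , K⊆J′ ∘ J⊆K , (λ _ → K⊆J′) ∷ max
    ... | no  J⊈K =
      let J′ , PJ′ , J⊆J′ , max = maximal-above Js PJs J PJ
      in J′ , PJ′ , J⊆J′ , (λ J′⊆K → ⊥-elim (J⊈K (J′⊆K ∘ J⊆J′))) ∷ max

    maximal-ideal : ∀ (D : DownClosed) {p} → p ∈ proj₁ D →
                    ∃ λ J → J ∈ IdealDecomp S (proj₁ D) × p ∈ set J
    maximal-ideal D p∈D =
      let Js , Js⊆D , D⊆Js = decompose D (⊊-acc D)
          J⊆D , p∈J = All.lookupAny Js⊆D (D⊆Js p∈D)
          J′ , J′⊆D , J⊆J′ , max = maximal-above Js Js⊆D (Any.lookup (D⊆Js p∈D)) J⊆D
      in J′ ,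
         -- Maximality among the listed ideals extends to every ideal K inside D, since by primeness
         -- K lies in one of them.
         (J′⊆D , λ K K⊆D J′⊆K →
           let K⊆J″ = ideal-prime Js K (D⊆Js ∘ K⊆D)
               J″-max , K⊆J = All.lookupAny max K⊆J″
           in J″-max (K⊆J ∘ J′⊆K) ∘ K⊆J) ,
         J⊆J′ p∈J

    post-ideal : ∀ {I a p} → p ∈ ↓ S (Post S (set I) a) → ∃ λ J → I ⟹[ a ] J × p ∈ set J
    post-ideal {I} {a} = maximal-ideal (↓-closed (Post S (set I) a))

-- Iteration in the completion

module _ {k} (S : TransitionSystem k 0ℓ 0ℓ 0ℓ) (em : ExcludedMiddle (lsuc 0ℓ)) (very : IsVeryWSTS S) where
  open TransitionSystem S using (_⟶[_]_) renaming (Carrier to X)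
  open TransitionSystem (completion S) using () renaming (_⟶[_]_ to _⟹[_]_)
  open IsVeryWSTS very
  open Ideal

  -- Each point of the right-hand side lies in some maximal ideal, which is an a-successor of I;
  -- determinism identifies that successor with J.
  ⟹-post : ∀ I J {a} → I ⟹[ a ] J → set J ≐ ↓ S (Post S (set I) a)
  ⟹-post I J I⟹J = proj₁ I⟹J , λ p∈ →
    let J′ , I⟹J′ , p∈J′ = post-ideal S em (IsWSTS.wqo isWSTS) {I} p∈
    in proj₂ (completionDeterministic {I} {J} {J′} I⟹J I⟹J′) p∈J′

  ⟹-⊆ : ∀ I I′ J J′ {a} → set I ⊆ set I′ → I ⟹[ a ] J → I′ ⟹[ a ] J′ → set J ⊆ set J′
  ⟹-⊆ I I′ J J′ I⊆I′ I⟹J I′⟹J′ p∈J =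
    let q , p≤q , s , s∈I , s⟶q = proj₁ (⟹-post I J I⟹J) p∈J
    in proj₂ (⟹-post I′ J′ I′⟹J′) (q , p≤q , s , I⊆I′ s∈I , s⟶q)

  path-⊆ : ∀ {I I′ w J J′} → set I ⊆ set I′ →
           Path (completion S) I w J → Path (completion S) I′ w J′ → set J ⊆ set J′
  path-⊆ I⊆I′ []       []         = I⊆I′
  path-⊆ {I} {I′} I⊆I′ (_∷_ {q = J} e es) (_∷_ {q = J′} e′ es′) =
    path-⊆ (⟹-⊆ I I′ J J′ I⊆I′ e e′) es es′

  -- With J = w(I), strict monotonicity carries I ⊂ J along w to J ⊂ w(J). So growth, once observed,
  -- persists under iteration.
  grows-strict : ∀ {I J J′ w} → set I ⊂ set J → Path (completion S) I w J′ → set J′ ≐ set J →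
                 Grows S w J
  grows-strict {J = J} I⊂J π (J′⊆J , J⊆J′) =
    let K , π′ , J′⊆K , K⊈J′ = path-strict (completion S) completionStrongStrict {p′ = J} π I⊂J
    in K , π′ , (λ p∈J → J′⊆K (J⊆J′ p∈J)) , λ K⊆J → K⊈J′ (λ p∈K → J⊆J′ (K⊆J p∈K))

  grows-next : ∀ {w I} (g : Grows S w I) → Grows S w (proj₁ g)
  grows-next (J , π , I⊂J) = grows-strict {J = J} I⊂J π (id , id)

  -- The recursion restarts from w(I), matching how `concat (replicate (suc n) w)` unfolds from the
  -- left.
  iterate : ∀ {w I} → Grows S w I → ℕ → Ideal S
  iterate {I = I} g zero    = I
  iterate         g (suc n) = iterate (grows-next g) n

  iterate-path : ∀ {w I} (g : Grows S w I) n →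
                 Path (completion S) I (concat (replicate n w)) (iterate g n)
  iterate-path g zero    = []
  iterate-path g (suc n) = path-++ (completion S) (proj₁ (proj₂ g)) (iterate-path (grows-next g) n)

  iterate-strict : ∀ {w I} (g : Grows S w I) → AccelerationCandidate S (iterate g)
  iterate-strict g zero    = proj₂ (proj₂ g)
  iterate-strict g (suc n) = iterate-strict (grows-next g) n

  increasing : ∀ f → AccelerationCandidate S f → ∀ {m n} → m ≤′ n → set (f m) ⊆ set (f n)
  increasing f f↑ ≤′-refl           p∈ = p∈
  increasing f f↑ (≤′-step {n} m≤n) p∈ = proj₁ (f↑ n) (increasing f f↑ m≤n p∈)

  iterates≐ : ∀ {w I} (g : Grows S w I) → iterates S w I ≐ ⋃ ℕ (set ∘ iterate g)
  iterates≐ g =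
    (λ { (n , J , π , p∈J) → n , path-⊆ id π (iterate-path g n) p∈J }) ,
    (λ { (n , p∈) → n , iterate g n , iterate-path g n , p∈ })

  ⋃-ideal : ∀ f → AccelerationCandidate S f → Ideal S
  ⋃-ideal f f↑ = record
    { set        = ⋃ ℕ (set ∘ f)
    ; nonempty   = proj₁ (nonempty (f 0)) , 0 , proj₂ (nonempty (f 0))
    ; downClosed = λ { p≤q (n , q∈) → n , downClosed (f n) p≤q q∈ }
    ; directed   = λ { {p} {q} (m , p∈) (n , q∈) →
        let s , s∈ , p≤s , q≤s = directed (f (m ⊔ n))
              (increasing f f↑ (ℕ.≤⇒≤′ (ℕ.m≤m⊔n m n)) p∈)
              (increasing f f↑ (ℕ.≤⇒≤′ (ℕ.m≤n⊔m m n)) q∈)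
        in s , (m ⊔ n , s∈) , p≤s , q≤s }
    }

  acceleration : ∀ w I → ∃ λ J → Acceleration S w I J
  acceleration w I with em {Grows S w I}
  ... | yes g = ⋃-ideal (iterate g) (iterate-strict g) ,
                inj₁ (g , proj₂ (iterates≐ g) , proj₁ (iterates≐ g))
  ... | no ¬g = I , inj₂ (¬g , id , id)

  -- By induction on n. If I is the union of a candidate f, the a-successors of its members, from an
  -- enabled one on, lie one level lower and increase strictly. Their union is J because Post
  -- commutes with unions.
  Idl-⟹ : ∀ n I J {a} → Idl S n I → I ⟹[ a ] J → Idl S n J
  Idl-⟹ zero    _ _ _ _ = tt
  Idl-⟹ (suc n) I J {a} (f , f↑ , f∈Idl , I≐⋃f) I⟹J =
    g , g↑ , (λ i → Idl-⟹ n (f (i + N)) (g i) (f∈Idl (i + N)) (f⟹g i)) ,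
    (λ p∈J → let q , p≤q , s , s∈I , s⟶q = proj₁ (⟹-post I J I⟹J) p∈J
                 m , s∈fm = proj₁ I≐⋃f s∈I
             in m , proj₂ (⟹-post (f (m + N)) (g m) (f⟹g m))
                  (q , p≤q , s , increasing f f↑ (ℕ.≤⇒≤′ (ℕ.m≤m+n m N)) s∈fm , s⟶q)) ,
    (λ { (m , p∈) →
       ⟹-⊆ (f (m + N)) I (g m) J (λ s∈ → proj₂ I≐⋃f (m + N , s∈)) (f⟹g m) I⟹J p∈ })
    where
    -- Since f N has an a-successor in S, f i ⟹[ a ] is enabled for i ≥ N.
    enabled : ∃ λ N → ∃ λ q → ∃ λ s → s ∈ set (f N) × s ⟶[ a ] q
    enabled = let _ , _ , s , s∈I , s⟶q = proj₁ I⟹J (proj₂ (nonempty J))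
                  N , s∈fN = proj₁ I≐⋃f s∈I
              in N , _ , s , s∈fN , s⟶q
    N : ℕ
    N = proj₁ enabled
    successors : ∀ i → ∃ λ K → f (i + N) ⟹[ a ] K
    successors i =
      let _ , q , s , s∈fN , s⟶q = enabled
          K , f⟹K , _ = post-ideal S em (IsWSTS.wqo isWSTS) {f (i + N)}
            (q , IsPreorder.refl (TransitionSystem.isQuasiOrder S) , s ,
             increasing f f↑ (ℕ.≤⇒≤′ (ℕ.m≤n+m N i)) s∈fN , s⟶q)
      in K , f⟹K
    g : ℕ → Ideal S
    g i = proj₁ (successors i)
    f⟹g : ∀ i → f (i + N) ⟹[ a ] g i
    f⟹g i = proj₂ (successors i)
    g↑ : AccelerationCandidate S g
    g↑ i =
      -- Strictness supplies some successor K of the next member; determinism identifies it with the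
      -- chosen `g (suc i)`.
      let K , f⟹K , gᵢ⊆K , K⊈gᵢ = proj₂ completionStrongStrict
            {f (i + N)} {g i} {f (suc i + N)} (f⟹g i) (f↑ (i + N))
          K⊆ , ⊆K = completionDeterministic {f (suc i + N)} {K} {g (suc i)} f⟹K (f⟹g (suc i))
      in (λ p∈ → K⊆ (gᵢ⊆K p∈)) , λ ⊆gᵢ → K⊈gᵢ (λ p∈ → ⊆gᵢ (K⊆ p∈))

  Idl-path : ∀ n {I w J} → Idl S n I → Path (completion S) I w J → Idl S n J
  Idl-path n I∈ []                 = I∈
  Idl-path n I∈ (_∷_ {q = J} e es) = Idl-path n (Idl-⟹ n _ J I∈ e) es

  -- Closure under successors keeps all iterates in level n, so they form an acceleration candidate
  -- there with union J.
  Idl-acceleration : ∀ n w I J → Idl S n I → Grows S w I → Acceleration S w I J →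
                     Idl S (suc n) J
  Idl-acceleration n w I J I∈ g (inj₁ (_ , J⊆ , ⊆J)) =
    iterate g , iterate-strict g , (λ i → Idl-path n I∈ (iterate-path g i)) ,
    (λ p∈ → proj₁ (iterates≐ g) (J⊆ p∈)) , λ p∈ → ⊆J (proj₂ (iterates≐ g) p∈)
  Idl-acceleration n w I J I∈ g (inj₂ (¬g , _)) = contradiction g ¬g

-- Subtrees built by the algorithm

-- The entry (a , w , l) stands for a proper ancestor labeled l, from which the
-- word a ∷ w leads to the current node.
Ancestry : ∀ {ℓ} → ℕ → Set ℓ → Set ℓ
Ancestry k A = List (Fin k × Word k × A)

extend : ∀ {k ℓ} {A : Set ℓ} → Fin k → A → Ancestry k A → Ancestry k A
extend b l Γ = (b , [] , l) ∷ map (λ { (a , w , l′) → a , w ++ [ b ] , l′ }) Γ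

module _ {k} (S : TransitionSystem k 0ℓ 0ℓ 0ℓ) where
  open TransitionSystem (completion S) using () renaming (_⟶[_]_ to _⟹[_]_)
  open Ideal

  Label : Set₁
  Label = Ideal S × ℕ

  label : Tree S → Label
  label t = Tree.ideal t , Tree.numaccel t

  -- An inductive form of `‼`, so that proofs can match along the path instead of unfolding the bind
  -- of `Maybe`.
  data At (t : Tree S) : Word k → Tree S → Set₁ where
    here  : At t [] t
    there : ∀ {a u s r} → Tree.child t a ≡ just s → At s u r → At t (a ∷ u) r

  at : ∀ {t} u {s} → (_‼_ S t u) ≡ just s → At t u s
  at []      refl = here
  at {t} (a ∷ u) located with Tree.child t a in eq
  ... | just _ = there eq (at u located)

  at⁻¹ : ∀ {t u s} → At t u s → (_‼_ S t u) ≡ just s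
  at⁻¹ here         = refl
  at⁻¹ (there eq o) rewrite eq = at⁻¹ o

  at-snoc : ∀ {t u s a r} → At t u s → Tree.child s a ≡ just r → At t (u ++ [ a ]) r
  at-snoc here         eq′ = there eq′ here
  at-snoc (there eq o) eq′ = there eq (at-snoc o eq′)

  -- With w empty this says that an address determines its subtree; with a single letter it recovers
  -- a child.
  at-suffix : ∀ {t u s v w r} → At t u s → At t v r → u ++ w ≡ v → At s w r
  at-suffix here         o refl = o
  at-suffix (there eq o) (there eq′ o′) u++w≡v with ∷-injective u++w≡v
  ... | refl , u++w≡v′ with just-injective (trans (sym eq) eq′)
  ... | refl = at-suffix o o′ u++w≡v′

  ancestry : ∀ {t u s} → Ancestry k Label → At t u s → Ancestry k Label
  ancestry Γ here                     = Γ
  ancestry {t} Γ (there {a = a} _ o) = ancestry (extend a (label t) Γ) o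

  ancestry-persistent : ∀ {Γ t u s b v l} → (b , v , l) ∈ˡ Γ → (o : At t u s) →
                        (b , v ++ u , l) ∈ˡ ancestry Γ o
  ancestry-persistent {Γ} {b = b} {v} {l} e∈ here =
    subst (λ w → (b , w , l) ∈ˡ Γ) (sym (++-identityʳ v)) e∈
  ancestry-persistent {b = b} {v} {l} e∈ o₀@(there {a = a} {u} _ o) =
    subst (λ w → (b , w , l) ∈ˡ ancestry _ o₀) (++-assoc v [ a ] u)
      (ancestry-persistent (there (∈-map⁺ _ e∈)) o)

  ancestry-complete : ∀ {Γ t u′ s′ u s a w} → At t u′ s′ → (o : At t u s) → u′ ++ a ∷ w ≡ u →
                      (a , w , label s′) ∈ˡ ancestry Γ o
  ancestry-complete here         (there _ o)    refl = ancestry-persistent (here refl) o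
  ancestry-complete (there eq o) (there eq′ o′) u′++w≡u with ∷-injective u′++w≡u
  ... | refl , u′++w≡u′ with just-injective (trans (sym eq) eq′)
  ... | refl = ancestry-complete o o′ u′++w≡u′

  ancestry-sound : ∀ {Γ t u s a w l} (o : At t u s) → (a , w , l) ∈ˡ ancestry Γ o →
    (∃ λ v → w ≡ v ++ u × (a , v , l) ∈ˡ Γ) ⊎
    (∃ λ u′ → ∃ λ s′ → At t u′ s′ × u′ ++ a ∷ w ≡ u × label s′ ≡ l)
  ancestry-sound {w = w} here e∈ = inj₁ (w , sym (++-identityʳ w) , e∈)
  ancestry-sound {t = t} (there {a = a} {u} eq o) e∈ with ancestry-sound o e∈
  ... | inj₂ (u′ , s′ , o′ , refl , l≡) = inj₂ (a ∷ u′ , s′ , there eq o′ , refl , l≡)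
  ... | inj₁ (v , refl , here refl) = inj₂ ([] , t , here , refl , refl)
  ... | inj₁ (v , refl , there e∈Γ) with ∈-map⁻ _ e∈Γ
  ... | (_ , v′ , _) , e∈Γ′ , refl = inj₁ (v′ , ++-assoc v′ [ a ] u , e∈Γ′)

  nodeAt : ∀ {t} (c : Node S t) → At t (Node.address c) (Node.subtree c)
  nodeAt c = at (Node.address c) (Node.located c)

  nodeOf : ∀ {t u s} → At t u s → Node S t
  nodeOf {u = u} {s} o = record { address = u ; subtree = s ; located = at⁻¹ o }

  ancestor-entry : ∀ {t w u s} (o : At t u s) (c′ : Node S t) → ¬ (w ≡ []) → Node.address c′ ++ w ≡ u →
                   ∃ λ a → ∃ λ v → w ≡ a ∷ v × (a , v , label (Node.subtree c′)) ∈ˡ ancestry [] o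
  ancestor-entry {w = []}    o c′ w≢[] _    = contradiction refl w≢[]
  ancestor-entry {w = a ∷ v} o c′ _    c′→c = a , v , refl , ancestry-complete (nodeAt c′) o c′→c

  entry-node : ∀ {t u s a w l} (o : At t u s) → (a , w , l) ∈ˡ ancestry [] o →
               ∃ λ c′ → Node.address c′ ++ a ∷ w ≡ u × label (Node.subtree {t = t} c′) ≡ l
  entry-node o e∈ with ancestry-sound o e∈
  ... | inj₁ (_ , _ , ())
  ... | inj₂ (u′ , s′ , o′ , u′w , l≡) = nodeOf o′ , u′w , l≡

  data Relabel (Γ : Ancestry k Label) (I : Ideal S) (n : ℕ) :
               Ideal S → ℕ → Maybe (Word k) → Set₁ where
    keep  : Relabel Γ I n I n nothing
    accel : ∀ {a w J m K} → (a , w , J , m) ∈ˡ Γ → set J ⊂ set I → Acceleration S (a ∷ w) I K →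
            Relabel Γ I n K (suc n) (just (a ∷ w))

  -- The subtrees that the algorithm can produce from a node created with
  -- label (I , n) below the ancestors Γ.
  data Built (Γ : Ancestry k Label) (I : Ideal S) (n : ℕ) : Tree S → Set₁

  data BuiltChild (Γ : Ancestry k Label) (I : Ideal S) (a : Fin k) (n : ℕ) :
                  Maybe (Tree S) → Set₁ where
    none : (∀ J → ¬ (I ⟹[ a ] J)) → BuiltChild Γ I a n nothing
    some : ∀ {J t} → I ⟹[ a ] J → Built Γ J n t → BuiltChild Γ I a n (just t)

  data Built Γ I n where
    pending : Built Γ I n (fresh S I n)
    closed  : ∀ {a w J m} → (a , w , J , m) ∈ˡ Γ → set J ≐ set I →
              Built Γ I n (node I n true nothing λ _ → nothing)
    opened  : ∀ {K m cause kids} → Relabel Γ I n K m cause →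
              (∀ a → BuiltChild (extend a (K , m) Γ) K a m (kids a)) →
              Built Γ I n (node K m true cause kids)

  child-built : ∀ {Γ I a n x t} → BuiltChild Γ I a n x → x ≡ just t →
                ∃ λ J → I ⟹[ a ] J × Built Γ J n t
  child-built (some {J} I⟹J b) refl = J , I⟹J , b

  -- Besides the construction of the subtree, this returns a way to plug in any other tree built
  -- under the same ancestors and creation label, which makes `Built` stable under `replaceAt`.
  built-at : ∀ {Γ I n t u s} → Built Γ I n t → (o : At t u s) →
    ∃ λ J → ∃ λ m → Built (ancestry Γ o) J m s ×
      (∀ {new} → Built (ancestry Γ o) J m new → Built Γ I n (replaceAt S u new t))
  built-at b here = _ , _ , b , id
  built-at {Γ} {I} {n} (opened {K} {m} {kids = kids} r bs) (there {a} {u} {s′} eq o) =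
    let J , K⟹J , b = child-built (bs a) eq
        _ , _ , b′ , rebuild = built-at b o
    in _ , _ , b′ , λ bnew → opened r (rebuilt J K⟹J (rebuild bnew))
    where
    -- The type spells out the child function of `replaceAt`, so that deciding `a ≟ b` reduces it.
    rebuilt : ∀ {new} J → K ⟹[ a ] J → Built (extend a (K , m) Γ) J m (replaceAt S u new s′) →
              ∀ b → BuiltChild (extend b (K , m) Γ) K b m
                (if Dec.does (a ≟ b) then Maybe.map (replaceAt S u new) (kids b) else kids b)
    rebuilt J K⟹J b′ b with a ≟ b
    ... | no _     = bs b
    ... | yes refl = subst (BuiltChild (extend a (K , m) Γ) K a m)
                           (cong (Maybe.map (replaceAt S u _)) (sym eq)) (some {J = J} K⟹J b′)

  unmarked-fresh : ∀ {Γ I n t} → Built Γ I n t → Tree.marked t ≡ false → t ≡ fresh S I n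
  unmarked-fresh pending refl = refl

  children-built : ∀ {Γ : Fin k → Ancestry k Label} {I n kids} → Children S I n kids →
                   ∀ a → BuiltChild (Γ a) I a n (kids a)
  children-built {Γ} ch a with ch a
  ... | inj₁ (J , I⟹J , eq) = subst (BuiltChild (Γ a) _ a _) (sym eq) (some {J = J} I⟹J pending)
  ... | inj₂ (stuck , eq)    = subst (BuiltChild (Γ a) _ a _) (sym eq) (none stuck)

  process-built : ∀ {t I n} (c : Node S t) → Built (ancestry [] (nodeAt c)) I n (Node.subtree c) →
                  Node.marked c ≡ false → ∀ {new} → Process S c new →
                  Built (ancestry [] (nodeAt c)) I n new
  process-built c@record { subtree = s } b unmarked p with unmarked-fresh b unmarked
  process-built c b unmarked (close c′ ((w , w≢[] , c′w) , same)) | refl =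
    let _ , _ , _ , e∈ = ancestor-entry (nodeAt c) c′ w≢[] c′w in closed e∈ same
  process-built c b unmarked (accelerate _ c′ w (w≢[] , c′w , c′⊂c , _) ac ch) | refl
    with ancestor-entry (nodeAt c) c′ w≢[] c′w
  ... | _ , _ , refl , e∈ = opened (accel e∈ c′⊂c ac) (children-built ch)
  process-built c b unmarked (expand _ _ ch) | refl = opened keep (children-built ch)

  -- This invariant replaces induction over the steps of the algorithm by induction over the tree.
  reachable-built : ∀ {I t} → Reachable S I t → Built [] I 0 t
  reachable-built start = pending
  reachable-built (step r c unmarked p) =
    let _ , _ , b , rebuild = built-at (reachable-built r) (nodeAt c)
    in rebuild (process-built c b unmarked p)

-- The stuttering and Karp–Miller automata

module _ {k} (S : TransitionSystem k 0ℓ 0ℓ 0ℓ) where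
  open TransitionSystem S using (_⟶[_]_; isQuasiOrder) renaming (Carrier to X; _≤_ to _⊑_)
  open TransitionSystem (completion S) using () renaming (_⟶[_]_ to _⟹[_]_)
  open Ideal
  private module ⊑ = IsPreorder isQuasiOrder

  -- E ⊆ ↓ Post(D, v) for the words v above u, where v may depend on the point of E.
  Covers : Pred X 0ℓ → Word k → Pred X 0ℓ → Set
  Covers D u E = ∀ {q} → q ∈ E → ∃ λ p → ∃ λ v → ∃ λ s → p ∈ D × u ≼ v × Path S p v s × q ⊑ s

  ⊇⇒covers : ∀ {D E} → E ⊆ D → Covers D [] E
  ⊇⇒covers E⊆D q∈E = _ , [] , _ , E⊆D q∈E , [] , [] , ⊑.refl

  covers-weaken : ∀ {D E u v} → u ≼ v → Covers D v E → Covers D u E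
  covers-weaken u≼v cov q∈E =
    let p , w , s , p∈D , v≼w , π , q⊑s = cov q∈E in p , w , s , p∈D , ⊆-trans u≼v v≼w , π , q⊑s

  ⟹-covers : ∀ I J {a} → I ⟹[ a ] J → Covers (set I) [ a ] (set J)
  ⟹-covers I J (J⊆ , _) q∈J =
    let s , q⊑s , p , p∈I , p⟶s = J⊆ q∈J in p , _ , s , p∈I , ⊆-refl , p⟶s ∷ [] , q⊑s

  module _ (mono : StronglyMonotone S) where

    -- The second path starts at a point q of E, which is only known to lie below some q′ reached
    -- from D; strong monotonicity replays the path from q′.
    covers-++ : ∀ {D E F u v} → Covers D u E → Covers E v F → Covers D (u ++ v) F
    covers-++ D→E E→F r∈F =
      let q , v′ , s , q∈E , v≼v′ , π , r⊑s  = E→F r∈F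
          p , u′ , q′ , p∈D , u≼u′ , ρ , q⊑q′ = D→E q∈E
          s′ , π′ , s⊑s′                      = path-mono S mono π q⊑q′
      in p , u′ ++ v′ , s′ , p∈D , ++⁺ u≼u′ v≼v′ , path-++ S ρ π′ , ⊑.trans r⊑s s⊑s′

    path-covers : ∀ {I w J} → Path (completion S) I w J → Covers (set I) w (set J)
    path-covers []                     = ⊇⇒covers id
    path-covers {I} {J = K} (_∷_ {q = J} e es) =
      covers-++ {set I} {set J} {set K} (⟹-covers I J e) (path-covers es)

    -- A point of the accelerated ideal lies in some iterate and is covered by a power of w, which
    -- has the empty word as a subword.
    acceleration-covers : ∀ {w} I J → Acceleration S w I J → Covers (set I) [] (set J)
    acceleration-covers I J (inj₂ (_ , J⊆I , _)) = ⊇⇒covers J⊆I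
    acceleration-covers I J (inj₁ (_ , J⊆ , _)) p∈J =
      let _ , K , π , p∈K = J⊆ p∈J
      in covers-weaken {set I} {set K} (minimum _) (path-covers π) p∈K

    relabel-covers : ∀ {Γ I n K m cause} → Relabel S Γ I n K m cause → Covers (set I) [] (set K)
    relabel-covers keep                   = ⊇⇒covers id
    relabel-covers {I = I} {K = K} (accel _ _ ac) = acceleration-covers I K ac

    built-covers : ∀ {Γ I n t} → Built S Γ I n t → Covers (set I) [] (set (Tree.ideal t))
    built-covers pending      = ⊇⇒covers id
    built-covers (closed _ _) = ⊇⇒covers id
    built-covers (opened r _) = relabel-covers r

    child-covers : ∀ {Γ I n t a s} → Built S Γ I n t → Tree.child t a ≡ just s →
                   Covers (set (Tree.ideal t)) [ a ] (set (Tree.ideal s))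
    child-covers {t = t} {a} {s} (opened r bs) eq =
      let J , K⟹J , b = child-built S (bs a) eq
      in covers-++ {set (Tree.ideal t)} {set J} {set (Tree.ideal s)}
           (⟹-covers (Tree.ideal t) J K⟹J) (built-covers b)

    at-covers : ∀ {Γ I n t u s} → Built S Γ I n t → At S t u s →
                Covers (set I) u (set (Tree.ideal s))
    at-covers b here = built-covers b
    at-covers {I = I} {s = s} (opened {K} r bs) (there {a} {u} eq o) =
      let J , K⟹J , b = child-built S (bs a) eq
      in covers-++ {set I} {set K} {set (Tree.ideal s)} (relabel-covers r)
           (covers-++ {set K} {set J} {set (Tree.ideal s)} (⟹-covers K J K⟹J) (at-covers b o))

    module _ {ℓ₁ ℓ₂} (M : Automaton k ℓ₁ ℓ₂) (D : Automaton.State M → Pred X 0ℓ) where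
      open Automaton M

      run-covers : (∀ {c α d} → move c α d → Covers (D c) (fromMaybe α) (D d)) →
                   ∀ {c w d} → Run M c w d → Covers (D c) w (D d)
      run-covers sound done         = ⊇⇒covers id
      run-covers sound {c} {d = e} (read {q = d} e₁ r) =
        covers-++ {D c} {D d} {D e} (sound e₁) (run-covers sound r)
      run-covers sound {c} {d = e} (silent {q = d} e₁ r) =
        covers-++ {D c} {D d} {D e} (sound e₁) (run-covers sound r)

  relabel-⊇ : ∀ {Γ I n K m cause} → Relabel S Γ I n K m cause → set I ⊆ set K
  relabel-⊇ keep                                       = id
  -- I is its own zeroth iterate.
  relabel-⊇ {I = I} (accel _ _ (inj₁ (_ , _ , ⊆K))) p∈ = ⊆K (0 , I , [] , p∈)
  relabel-⊇         (accel _ _ (inj₂ (_ , _ , I⊆K))) p∈ = I⊆K p∈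

  built-cause : ∀ {Γ I n t w} → Built S Γ I n t → Tree.cause t ≡ just w →
    ∃ λ a → ∃ λ v → ∃ λ J → ∃ λ m →
      w ≡ a ∷ v × (a , v , J , m) ∈ˡ Γ × set J ⊆ set (Tree.ideal t)
  built-cause (opened r@(accel {a} {w} {J} {m} e∈ (J⊆I , _) _) _) refl =
    a , w , J , m , refl , e∈ , (λ p∈J → relabel-⊇ r (J⊆I p∈J))

  built-⊇ : ∀ {Γ I n t} → Built S Γ I n t → set I ⊆ set (Tree.ideal t)
  built-⊇ pending      = id
  built-⊇ (closed _ _) = id
  built-⊇ (opened r _) = relabel-⊇ r

  module _ {ℓ₁ ℓ₂} (M : Automaton k ℓ₁ ℓ₂) where
    open Automaton M

    run-++ : ∀ {c d e u v} → Run M c u d → Run M d v e → Run M c (u ++ v) e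
    run-++ done         r′ = r′
    run-++ (read e r)   r′ = read e (run-++ r r′)
    run-++ (silent e r) r′ = silent e (run-++ r r′)

    simulate : (D : State → Pred X 0ℓ) →
      (∀ {c p a q} → p ∈ D c → p ⟶[ a ] q → ∃ λ d → Run M c [ a ] d × q ∈ D d) →
      ∀ {c p w q} → p ∈ D c → Path S p w q → ∃ λ d → Run M c w d × q ∈ D d
    simulate D follow p∈ []       = _ , done , p∈
    simulate D follow p∈ (e ∷ es) =
      let _ , r , q∈  = follow p∈ e
          d , r′ , s∈ = simulate D follow q∈ es
      in d , run-++ r r′ , s∈

  module _ (em : ExcludedMiddle (lsuc 0ℓ)) (very : IsVeryWSTS S)
           {I t} (reachable : Reachable S I t) where
    open IsVeryWSTS very
    open Node

    private
      node-built : ∀ c → ∃ λ J → ∃ λ m → Built S (ancestry S [] (nodeAt S c)) J m (subtree c)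
      node-built c = let J , m , b , _ = built-at S (reachable-built S reachable) (nodeAt S c)
                     in J , m , b

    arc-child : ∀ (c d : Node S t) {a} → Descends S c [ a ] d → Tree.child (subtree c) a ≡ just (subtree d)
    arc-child c d c→d with at-suffix S (nodeAt S c) (nodeAt S d) c→d
    ... | there eq here = eq

    arc-covers : ∀ (c d : Node S t) {a} → Descends S c [ a ] d → Covers (set (ideal c)) [ a ] (set (ideal d))
    arc-covers c d c→d =
      child-covers stronglyMonotone {s = subtree d} (proj₂ (proj₂ (node-built c))) (arc-child c d c→d)

    -- The ancestor that caused the acceleration and c′ both lead to c by the same word. Cancelling
    -- it shows that their addresses agree, hence their ideals; acceleration only enlarges the ideal
    -- of c.
    cause-⊆ : ∀ {c c′ : Node S t} {w} → cause c ≡ just w → Descends S c′ w c → set (ideal c′) ⊆ set (ideal c)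
    cause-⊆ {c} {c′} caused c′→c with built-cause (proj₂ (proj₂ (node-built c))) caused
    ... | a , v , J , m , refl , e∈ , J⊆c with entry-node S (nodeAt S c) e∈
    ... | c″ , c″→c , refl
      with at-suffix S (nodeAt S c′) (nodeAt S c″)
             (trans (++-identityʳ _) (++-cancelʳ (a ∷ v) (address c′) (address c″) (trans c′→c (sym c″→c))))
    ... | o = same-ideal o J⊆c
      where
      same-ideal : ∀ {s s′} → At S s [] s′ → set (Tree.ideal s′) ⊆ set (ideal c) →
                   set (Tree.ideal s) ⊆ set (ideal c)
      same-ideal here s⊆c = s⊆c

    move-covers : ∀ {c α d} → KarpMillerMove S t c α d →
                  Covers (set (ideal c)) (fromMaybe α) (set (ideal d))
    move-covers {c} {d = d} (stuttering (arc c→d))          = arc-covers c d c→d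
    move-covers (stuttering (loop _ _ (_ , d⊆c))) = ⊇⇒covers d⊆c
    move-covers {c} {d = d} (back caused d→c)               = ⊇⇒covers (cause-⊆ {c} {d} caused d→c)

    node-covers : ∀ c → Covers (set I) (address c) (set (ideal c))
    node-covers c = at-covers stronglyMonotone (reachable-built S reachable) (nodeAt S c)

    root-⊇ : set I ⊆ set (Tree.ideal t)
    root-⊇ = built-⊇ (reachable-built S reachable)

    -- With an empty ancestry, the root can be neither closed nor accelerated, so it keeps its
    -- label.
    root-⊆ : set (Tree.ideal t) ⊆ set I
    root-⊆ with reachable-built S reachable
    ... | pending     = id
    ... | opened keep _ = id

    -- A step from inside K forces an a-successor of K to exist, so the child is present, and this
    -- successor contains the whole post.
    follow-child : ∀ {Γ K m x p a q} → BuiltChild S Γ K a m x → p ∈ set K → p ⟶[ a ] q →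
                   ∃ λ s → x ≡ just s × q ∈ set (Tree.ideal s)
    follow-child {K = K} {p = p} {q = q} (none stuck) p∈K p⟶q =
      let J , K⟹J , _ = post-ideal S em (IsWSTS.wqo isWSTS) {K} (q , ⊑.refl , p , p∈K , p⟶q)
      in ⊥-elim (stuck J K⟹J)
    follow-child {K = K} {p = p} {q = q} (some {J} {s} K⟹J b) p∈K p⟶q =
      s , refl , built-⊇ b (proj₂ (⟹-post S em very K J K⟹J) (q , ⊑.refl , p , p∈K , p⟶q))

    follow-inner : ∀ {Γ J m s b r} → Built S Γ J m s → Tree.child s b ≡ just r →
      ∀ {p a q} → p ∈ set (Tree.ideal s) → p ⟶[ a ] q →
      ∃ λ s′ → Tree.child s a ≡ just s′ × q ∈ set (Tree.ideal s′)
    follow-inner (opened _ bs) _ = follow-child (bs _)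

    stuttering-step : (∀ c → marked c ≡ true) → ∀ {c p a q} → p ∈ set (ideal c) → p ⟶[ a ] q →
                      ∃ λ d → Run (𝒜 S t) c [ a ] d × q ∈ set (ideal d)
    stuttering-step finished {c} p∈c p⟶q with node-built c | finished c
    stuttering-step finished {c@record {}} p∈c p⟶q | _ , _ , pending | ()
    stuttering-step finished {c@record {}} p∈c p⟶q | _ , _ , opened _ bs | _ =
      let s , eq , q∈s = follow-child (bs _) p∈c p⟶q
      in nodeOf S (at-snoc S (nodeAt S c) eq) , read (arc refl) done , q∈s
    stuttering-step finished {c@record {}} p∈c p⟶q | _ , _ , closed e∈ (J⊆I , I⊆J) | _
      with entry-node S (nodeAt S c) e∈
    ... | c′ , c′→c , refl with at-suffix S (nodeAt S c′) (nodeAt S c) c′→c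
    -- c lies strictly below c′, so c′ has a child and must have been opened: after one ε-transition
    -- the letter can be read.
    ... | there inner _ =
      let s , eq , q∈s = follow-inner (proj₂ (proj₂ (node-built c′))) inner (I⊆J p∈c) p⟶q
      in nodeOf S (at-snoc S (nodeAt S c′) eq) ,
         silent {q = c′} (loop (λ _ → refl) c′→c (I⊆J , J⊆I)) (read (arc refl) done) , q∈s

    module _ (finished : ∀ (c : Node S t) → marked c ≡ true) where

      traces-⊆ : Tracesˢ S (set I) ⊆ L (𝒜 S t)
      traces-⊆ (p , p∈I , q , π) =
        let d , r , _ = simulate (𝒜 S t) (set ∘ ideal) (stuttering-step finished) {root S t} (root-⊇ p∈I) π
        in d , r , tt

      D≐↓Post* : D S t ≐ ↓ S (Post*ˢ S (set I))
      D≐↓Post* =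
        (λ { (c , q∈c) → let p , _ , s , p∈I , _ , π , q⊑s = node-covers c q∈c
                         in s , q⊑s , p , p∈I , _ , π }) ,
        (λ { (s , q⊑s , p , p∈I , _ , π) →
             let d , _ , s∈d = simulate (𝒜 S t) (set ∘ ideal) (stuttering-step finished) {root S t} (root-⊇ p∈I) π
             in d , downClosed (ideal d) q⊑s s∈d })

    L𝒦-⊆ : L (𝒦 S t) ⊆ ↓≼ (Tracesˢ S (set I))
    L𝒦-⊆ (d , r , _) =
      -- Covering speaks of points, and nonemptiness of the last ideal provides one from which a
      -- trace is obtained.
      let q , q∈d = nonempty (ideal d)
          p , v , s , p∈ , u≼v , π , _ =
            run-covers stronglyMonotone (𝒦 S t) (set ∘ ideal) (λ {c} {α} {d} → move-covers {c} {α} {d}) r q∈d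
      in v , u≼v , p , root-⊆ p∈ , s , π

-- The algorithm on codes

module _ {k} (S : TransitionSystem k 0ℓ 0ℓ 0ℓ) where
  open Tree using (child; marked)

  -- Children being functions, iterated replacements can be compared only node by node.
  data SameOutside : Word k → Tree S → Tree S → Set₁ where
    here  : ∀ {t t′} → SameOutside [] t t′
    there : ∀ {a u t t′ s s′} → label S t ≡ label S t′ → marked t ≡ marked t′ →
            (∀ b → ¬ (a ≡ b) → child t b ≡ child t′ b) →
            child t a ≡ just s → child t′ a ≡ just s′ → SameOutside u s s′ → SameOutside (a ∷ u) t t′

  same-refl : ∀ {t u s} → At S t u s → SameOutside u t t
  same-refl here         = here
  same-refl (there eq o) = there refl refl (λ _ _ → refl) eq eq (same-refl o)

  same-trans : ∀ {u t t′ t″} → SameOutside u t t′ → SameOutside u t′ t″ → SameOutside u t t″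
  same-trans here here = here
  same-trans (there l m ch eq eq₁ σ) (there l′ m′ ch′ eq₁′ eq′ σ′)
    with just-injective (trans (sym eq₁) eq₁′)
  ... | refl = there (trans l l′) (trans m m′) (λ b a≢b → trans (ch b a≢b) (ch′ b a≢b))
                     eq eq′ (same-trans σ σ′)

  -- This serves to view a change inside a child as a change of its parent, taking for v a single
  -- letter.
  same-split : ∀ {u v t t′ s} → SameOutside (u ++ v) t t′ → At S t u s →
               ∃ λ s′ → At S t′ u s′ × SameOutside v s s′ × SameOutside u t t′
  same-split σ here = _ , here , σ , here
  same-split (there l m ch eq eq′ σ) (there eq₁ o) with just-injective (trans (sym eq) eq₁)
  ... | refl = let s′ , o′ , σ₁ , σ₂ = same-split σ o
               in s′ , there eq′ o′ , σ₁ , there l m ch eq eq′ σ₂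

  child-replaceAt : ∀ a u new t → child (replaceAt S (a ∷ u) new t) a ≡
                    Maybe.map (replaceAt S u new) (child t a)
  child-replaceAt a u new t with a ≟ a
  ... | yes _   = refl
  ... | no a≢a = contradiction refl a≢a

  sibling-replaceAt : ∀ a u new t b → ¬ (a ≡ b) → child t b ≡ child (replaceAt S (a ∷ u) new t) b
  sibling-replaceAt a u new t b a≢b with a ≟ b
  ... | yes a≡b = contradiction a≡b a≢b
  ... | no _    = refl

  at-replaceAt : ∀ {t u s new} → At S t u s →
                 At S (replaceAt S u new t) u new × SameOutside u t (replaceAt S u new t)
  at-replaceAt here = here , here
  at-replaceAt {t} {new = new} (there {a} {u} eq o) =
    let o′ , σ = at-replaceAt o
        eq′    = trans (child-replaceAt a u new t) (cong (Maybe.map (replaceAt S u new)) eq)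
    in there eq′ o′ , there refl refl (sibling-replaceAt a u new t) eq eq′ σ

  ancestry-same : ∀ {Γ u t t′ s s′} → SameOutside u t t′ → (o : At S t u s) (o′ : At S t′ u s′) →
                  ancestry S Γ o′ ≡ ancestry S Γ o
  ancestry-same here here here = refl
  ancestry-same (there l _ _ eq eq′ σ) (there eq₁ o) (there eq₁′ o′)
    with just-injective (trans (sym eq) eq₁) | just-injective (trans (sym eq′) eq₁′)
  ... | refl | refl rewrite l = ancestry-same σ o o′

  ancestry-snoc : ∀ {Γ t u s a r} (o : At S t u s) (eq : child s a ≡ just r) →
                  ancestry S Γ (at-snoc S o eq) ≡ extend a (label S s) (ancestry S Γ o)
  ancestry-snoc here         eq′ = refl
  ancestry-snoc (there eq o) eq′ = ancestry-snoc o eq′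

allJust : ∀ {ℓ k} {P : Fin k → Set ℓ} → (∀ a → Maybe (P a)) → Maybe (∀ a → P a)
allJust {k = zero}  f = just λ ()
allJust {k = suc k} f with f Fin.zero | allJust (f ∘ Fin.suc)
... | just p | just ps = just λ { Fin.zero → p ; (Fin.suc a) → ps a }
... | _      | _       = nothing

module _ {k} (S : TransitionSystem k 0ℓ 0ℓ 0ℓ) (eff : Effective S) where
  open Effective eff
  open TransitionSystem (completion S) using () renaming (_⟶[_]_ to _⟹[_]_)
  open Ideal

  Codes : Set
  Codes = Ancestry k (Code × ℕ)

  Successor : Code → Fin k → Set₁
  Successor c a = (∃ λ d → ⟦ c ⟧ ⟹[ a ] ⟦ d ⟧) ⊎ (∀ J → ¬ (⟦ c ⟧ ⟹[ a ] J))

  Repeated : Codes → Code → Set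
  Repeated Γ c = Any (λ { (_ , _ , d , _) → set ⟦ d ⟧ ≐ set ⟦ c ⟧ }) Γ

  Dominated : Codes → Code → ℕ → Set
  Dominated Γ c n = Any (λ { (_ , _ , d , m) → set ⟦ d ⟧ ⊂ set ⟦ c ⟧ × m ≡ n }) Γ

  repeated? : ∀ Γ c → Dec (Repeated Γ c)
  repeated? Γ c = Any.any? (λ { (_ , _ , d , _) → inclusion? d c ×-dec inclusion? c d }) Γ

  dominated? : ∀ Γ c n → Dec (Dominated Γ c n)
  dominated? Γ c n = Any.any? (λ { (_ , _ , d , m) →
    (inclusion? d c ×-dec ¬? (inclusion? c d)) ×-dec (m ℕ.≟ n) }) Γ

  -- Ancestries list the nearest ancestor first and `dominated?` searches from the front, so the
  -- nearest dominating ancestor is the one chosen.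
  relabel : ∀ {Γ c n} → Dec (Dominated Γ c n) → Code × ℕ
  relabel {c = c} {n} (yes dom) = let a , w , _ = Any.lookup dom in proj₁ (power a w c) , suc n
  relabel {c = c} {n} (no _)    = c , n

  post : Codes → Code → ℕ → Code × ℕ
  post Γ c n = relabel (dominated? Γ c n)

  -- A run of the algorithm on codes, from a node created with label (⟦ c ⟧ , n)
  -- below the ancestors Γ.
  data Plan (Γ : Codes) (c : Code) (n : ℕ) : Set₁

  data ChildPlan (Γ : Codes) (n : ℕ) {c : Code} {a : Fin k} : Successor c a → Set₁ where
    branch : ∀ {d c⟹d} → Plan Γ d n → ChildPlan Γ n (inj₁ (d , c⟹d))
    stuck  : ∀ {¬⟹} → ChildPlan Γ n (inj₂ ¬⟹)

  ChildPlans : Codes → Code × ℕ → Set₁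
  ChildPlans Γ (c , n) = ∀ a → ChildPlan (extend a (c , n) Γ) n (successor c a)

  data Plan Γ c n where
    stop : Repeated Γ c → Plan Γ c n
    grow : ¬ Repeated Γ c → ChildPlans Γ (post Γ c n) → Plan Γ c n

  -- Recursion on fuel keeps the procedure constructive, while termination is proved separately with
  -- excluded middle. The result `nothing` means too little fuel for the depth.
  plan      : ℕ → ∀ Γ c n → Maybe (Plan Γ c n)
  childPlan : ℕ → ∀ Γ n {c a} (x : Successor c a) → Maybe (ChildPlan Γ n x)

  plan zero       Γ c n = nothing
  plan (suc fuel) Γ c n with repeated? Γ c
  ... | yes r = just (stop r)
  ... | no ¬r = let d , m = post Γ c n in
                Maybe.map (grow ¬r) (allJust λ a → childPlan fuel (extend a (d , m) Γ) m (successor d a))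

  childPlan fuel Γ n (inj₁ (d , _)) = Maybe.map branch (plan fuel Γ d n)
  childPlan fuel Γ n (inj₂ _)       = just stuck

  decode : Codes → Ancestry k (Label S)
  decode = map λ { (a , w , c , n) → a , w , ⟦ c ⟧ , n }

  decode-extend : ∀ a c n Γ → decode (extend a (c , n) Γ) ≡ extend a (⟦ c ⟧ , n) (decode Γ)
  decode-extend a c n Γ = cong (_ ∷_) (trans (sym (map-∘ Γ)) (map-∘ Γ))

  toChild : ∀ {c a} → ℕ → Successor c a → Maybe (Tree S)
  toChild n (inj₁ (d , _)) = just (fresh S ⟦ d ⟧ n)
  toChild n (inj₂ _)       = nothing

  children : ∀ c n → Children S ⟦ c ⟧ n (λ a → toChild n (successor c a))
  children c n a with successor c a
  ... | inj₁ (d , c⟹d) = inj₁ (⟦ d ⟧ , c⟹d , refl)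
  ... | inj₂ disabled   = inj₂ (disabled , refl)

  -- A code is kept for the ideal of every node, because the automaton read off the tree must decide
  -- inclusions between them.
  data Done : Tree S → Set₁ where
    done : ∀ {t} → Tree.marked t ≡ true → (∃ λ c → Tree.ideal t ≡ ⟦ c ⟧) →
           (∀ a {s} → Tree.child t a ≡ just s → Done s) → Done t

  done-at : ∀ {t u s} → Done t → At S t u s → Tree.marked s ≡ true × ∃ λ c → Tree.ideal s ≡ ⟦ c ⟧
  done-at (done m c _)  here         = m , c
  done-at (done _ _ ch) (there eq o) = done-at (ch _ eq) o

  module _ {Γ : Codes} {c : Code} {n : ℕ} {t : Tree S} {u : Word k}
           (o : At S t u (fresh S ⟦ c ⟧ n)) (anc : ancestry S [] o ≡ decode Γ) where

    private
      node-entry : ∀ {w} (c′ : Node S t) → ¬ (w ≡ []) → Descends S c′ w (nodeOf S o) →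
                   ∃ λ a → ∃ λ v → ∃ λ d → ∃ λ m → w ≡ a ∷ v ×
                     (a , v , d , m) ∈ˡ Γ × label S (Node.subtree c′) ≡ (⟦ d ⟧ , m)
      node-entry {w} c′ w≢[] c′→c with ancestor-entry S o c′ w≢[] c′→c
      ... | a , v , w≡ , e∈ with ∈-map⁻ _ (subst ((a , v , _) ∈ˡ_) anc e∈)
      ... | (a , v , d , m) , e∈Γ , refl = a , v , d , m , w≡ , e∈Γ , refl

      entry-ancestor : ∀ {a v d m} → (a , v , d , m) ∈ˡ Γ →
                       ∃ λ c′ → Descends S c′ (a ∷ v) (nodeOf S o) × label S (Node.subtree c′) ≡ (⟦ d ⟧ , m)
      entry-ancestor e∈Γ = entry-node S o (subst (_ ∈ˡ_) (sym anc) (∈-map⁺ _ e∈Γ))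

    repeats : Repeated Γ c → ∃ λ c′ → Repeats S c′ (nodeOf S o)
    repeats r with find r
    ... | _ , e∈Γ , same with entry-ancestor e∈Γ
    ... | c′ , c′→c , refl = c′ , (_ , (λ ()) , c′→c) , same

    repeated : ∀ c′ → Repeats S c′ (nodeOf S o) → Repeated Γ c
    repeated c′ ((w , w≢[] , c′→c) , same) with node-entry c′ w≢[] c′→c
    ... | _ , _ , _ , _ , _ , e∈Γ , refl = lose e∈Γ same

    process : ¬ Repeated Γ c → (dom? : Dec (Dominated Γ c n)) →
              let d , m = relabel dom? in
              ∃ λ w → Process S (nodeOf S o) (node ⟦ d ⟧ m true w λ a → toChild m (successor d a))
    process ¬r (no ¬dom) = nothing , expand (λ c′ → ¬r ∘ repeated c′) undominated (children c n)
      where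
      undominated : ∀ c′ w → ¬ Dominates S c′ w (nodeOf S o)
      undominated c′ w (w≢[] , c′→c , c′⊂c , m≡n) with node-entry c′ w≢[] c′→c
      ... | _ , _ , _ , _ , _ , e∈Γ , refl = ¬dom (lose e∈Γ (c′⊂c , m≡n))
    process ¬r (yes dom) with Any.lookup dom | lookup-entry dom
      where
      lookup-entry : ∀ {Δ} (dom : Dominated Δ c n) → let a , w , d , m = Any.lookup dom in
                     (a , w , d , m) ∈ˡ Δ × set ⟦ d ⟧ ⊂ set ⟦ c ⟧ × m ≡ n
      lookup-entry (here p)    = here refl , p
      lookup-entry (there dom) = let e∈ , p = lookup-entry dom in there e∈ , p
    ... | a , w , _ | e∈Γ , ⊂c , m≡n with entry-ancestor e∈Γ
    ... | c′ , c′→c , refl = just (a ∷ w) ,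
      accelerate (λ c″ → ¬r ∘ repeated c″) c′ (a ∷ w) ((λ ()) , c′→c , ⊂c , m≡n)
                 (proj₂ (power a w c)) (children (proj₁ (power a w c)) (suc n))

  Completes : Ideal S → Word k → Tree S → Set₁
  Completes I u t = ∃ λ t′ → Reachable S I t′ × ∃ λ s → At S t′ u s × SameOutside S u t t′ × Done s

  -- This realizes a plan as steps of the algorithm, depth first: the node is processed, then its
  -- children are completed one after the other. `SameOutside` preserves the ancestry that later
  -- children rely on.
  execute : ∀ {Γ c n} → Plan Γ c n → ∀ {I t u} → Reachable S I t →
            (o : At S t u (fresh S ⟦ c ⟧ n)) → ancestry S [] o ≡ decode Γ → Completes I u t

  -- The list `as` holds the letters still to visit. Each letter is either there with its child as
  -- created, or its child, if any, is complete.
  execute-children :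
    ∀ {Γ c n} → ChildPlans Γ (c , n) → ∀ (as : List (Fin k)) {I t u s} → Reachable S I t →
    (o : At S t u s) → ancestry S [] o ≡ decode Γ →
    label S s ≡ (⟦ c ⟧ , n) → Tree.marked s ≡ true →
    (∀ a → (a ∈ˡ as × Tree.child s a ≡ toChild n (successor c a)) ⊎
           (∀ r → Tree.child s a ≡ just r → Done r)) →
    Completes I u t

  execute-child :
    ∀ {Γ c n a} {x : Successor c a} → ChildPlan Γ n x → ∀ {I t u s} → Reachable S I t →
    (o : At S t u s) → extend a (label S s) (ancestry S [] o) ≡ decode Γ →
    Tree.child s a ≡ toChild n x →
    ∃ λ t′ → Reachable S I t′ × ∃ λ s′ → At S t′ u s′ × SameOutside S u t t′ ×
      label S s ≡ label S s′ × Tree.marked s ≡ Tree.marked s′ ×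
      (∀ b → ¬ (a ≡ b) → Tree.child s b ≡ Tree.child s′ b) ×
      (∀ r → Tree.child s′ a ≡ just r → Done r)

  execute {c = c} {n} (stop r) R o anc =
    let c′ , rep = repeats o anc r
        o′ , σ   = at-replaceAt S o
    in _ , step R (nodeOf S o) refl (close c′ rep) , _ , o′ , σ , done refl (c , refl) λ _ ()
  execute {Γ} {c} {n} (grow ¬r ps) R o anc =
    let w , p  = process o anc ¬r (dominated? Γ c n)
        o′ , σ = at-replaceAt S o
        t″ , R″ , s , o″ , σ′ , d =
          execute-children ps (allFin k) (step R (nodeOf S o) refl p) o′
            (trans (ancestry-same S σ o o′) anc) refl refl λ a → inj₁ (∈-allFin a , refl)
    in t″ , R″ , s , o″ , same-trans S σ σ′ , d

  execute-children {c = c} ps [] {t = t} {s = s} R o anc l m ch =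
    t , R , s , o , same-refl S o , done m (c , cong proj₁ l) λ a → case ch a of λ { (inj₁ ()) ; (inj₂ d) → d _ }
  execute-children {Γ} {c} {n} ps (a ∷ as) {s = s} R o anc l m ch with ch a
  ... | inj₂ d = execute-children ps as R o anc l m λ b → case ch b of λ
    { (inj₂ d′)              → inj₂ d′
    ; (inj₁ (here refl , _)) → inj₂ d
    ; (inj₁ (there b∈ , eq)) → inj₁ (b∈ , eq) }
  ... | inj₁ (_ , eq) with execute-child (ps a) R o
          (trans (cong (λ Δ → extend a Δ _) l)
          (trans (cong (extend a _) anc) (sym (decode-extend a c n Γ)))) eq
  ... | t′ , R′ , s′ , o′ , σ , l′ , m′ , siblings , d =
    let t″ , R″ , s″ , o″ , σ′ , d′ =
          execute-children ps as R′ o′ (trans (ancestry-same S σ o o′) anc)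
            (trans (sym l′) l) (trans (sym m′) m) remaining
    in t″ , R″ , s″ , o″ , same-trans S σ σ′ , d′
    where
    remaining : ∀ b → (b ∈ˡ as × Tree.child s′ b ≡ toChild n (successor c b)) ⊎
                      (∀ r → Tree.child s′ b ≡ just r → Done r)
    remaining b with a ≟ b
    ... | yes refl = inj₂ d
    ... | no a≢b with ch b
    ... | inj₂ d′              = inj₂ λ r eq → d′ r (trans (siblings b a≢b) eq)
    ... | inj₁ (here refl , _) = contradiction refl a≢b
    ... | inj₁ (there b∈ , eq) = inj₁ (b∈ , trans (sym (siblings b a≢b)) eq)

  execute-child stuck {s = s} R o anc eq =
    _ , R , s , o , same-refl S o , refl , refl , (λ _ _ → refl) ,
    λ _ eq′ → case trans (sym eq) eq′ of λ ()
  execute-child (branch p) R o anc eq with execute p R (at-snoc S o eq) (trans (ancestry-snoc S o eq) anc)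
  -- All changes lie below `u ++ [ a ]`, so the node at u keeps its label, its mark and its other
  -- children.
  ... | t′ , R′ , r , oʳ , σ , d with same-split S σ o
  ... | s′ , o′ , there l m siblings _ eq′ here , σ′
    with at-suffix S o′ oʳ refl
  ... | there eq″ here =
    t′ , R′ , s′ , o′ , σ′ , l , m , siblings ,
    λ _ eq₁ → subst Done (just-injective (trans (sym eq″) eq₁)) d

-- Termination

is-just-map⁺ : ∀ {a b} {A : Set a} {B : Set b} {f : A → B} {x} → Is-just x → Is-just (Maybe.map f x)
is-just-map⁺ (just _) = just _

is-just-map⁻ : ∀ {a b} {A : Set a} {B : Set b} {f : A → B} {x} → Is-just (Maybe.map f x) → Is-just x
is-just-map⁻ {x = just _} _ = just _

allJust⁺ : ∀ {ℓ k} {P : Fin k → Set ℓ} (f : ∀ a → Maybe (P a)) → (∀ a → Is-just (f a)) → Is-just (allJust f)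
allJust⁺ {k = zero}  f js = just _
allJust⁺ {k = suc k} f js
  with f Fin.zero | allJust (f ∘ Fin.suc) | js Fin.zero | allJust⁺ (f ∘ Fin.suc) (js ∘ Fin.suc)
... | just _ | just _ | _ | _ = just _

allJust⁻ : ∀ {ℓ k} {P : Fin k → Set ℓ} (f : ∀ a → Maybe (P a)) → Is-just (allJust f) → ∀ a → Is-just (f a)
allJust⁻ {k = suc k} f j a with f Fin.zero in eq₀ | allJust (f ∘ Fin.suc) in eq
allJust⁻ {k = suc k} f j Fin.zero    | just _ | just _ = subst Is-just (sym eq₀) (just _)
allJust⁻ {k = suc k} f j (Fin.suc a) | just _ | just _ =
  allJust⁻ (f ∘ Fin.suc) (subst Is-just (sym eq) (just _)) a

bounded : ∀ {k} (f : Fin k → ℕ) → ∃ λ N → ∀ a → f a ℕ.≤ N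
bounded {zero}  f = 0 , λ ()
bounded {suc k} f =
  let N , ≤N = bounded (f ∘ Fin.suc)
  in f Fin.zero ⊔ N , λ { Fin.zero    → ℕ.m≤m⊔n _ N
                        ; (Fin.suc a) → ℕ.≤-trans (≤N a) (ℕ.m≤n⊔m (f Fin.zero) N) }

module _ (em : ExcludedMiddle 0ℓ) (g : ℕ → ℕ) (g↑ : ∀ i → g i ℕ.≤ g (suc i)) where

  private
    mono : ∀ {i j} → i ≤′ j → g i ℕ.≤ g j
    mono ≤′-refl         = ℕ.≤-refl
    mono (≤′-step i≤j) = ℕ.≤-trans (mono i≤j) (g↑ _)

  eventually-constant : ∀ {B} → (∀ i → g i < B) → ∃ λ N → ∀ i → g (i + N) ≡ g N
  eventually-constant {B} g<B = climb B 0 (ℕ.m≤m+n B (g 0))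
    where
    -- The budget b bounds how much g can still rise above `g N`: each strict rise consumes at least
    -- one unit, and an exhausted budget contradicts the bound B.
    climb : ∀ b N → B ℕ.≤ b + g N → ∃ λ N → ∀ i → g (i + N) ≡ g N
    climb zero    N B≤ = contradiction (g<B N) (ℕ.≤⇒≯ B≤)
    climb (suc b) N B≤ with em {∃ λ i → g N < g (i + N)}
    ... | yes (i , lt) = climb b (i + N)
      (ℕ.≤-trans B≤ (ℕ.≤-trans (ℕ.≤-reflexive (sym (ℕ.+-suc b (g N)))) (ℕ.+-monoʳ-≤ b lt)))
    ... | no ¬above = N , λ i →
      ℕ.≤-antisym (ℕ.≮⇒≥ λ lt → ¬above (i , lt)) (mono (ℕ.≤⇒≤′ (ℕ.m≤n+m N i)))

module _ {k} (S : TransitionSystem k 0ℓ 0ℓ 0ℓ) (eff : Effective S) where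
  open Effective eff
  open TransitionSystem (completion S) using () renaming (_⟶[_]_ to _⟹[_]_)
  open Ideal

  Config : Set
  Config = Codes S eff × Code × ℕ

  postᶜ : Config → Code × ℕ
  postᶜ (Γ , c , n) = post S eff Γ c n

  -- A configuration is a node at its creation, and s′ is a child created by processing s.
  -- Accessibility thus means that no infinite branch starts at the node.
  _◁_ : Config → Config → Set₁
  s′ ◁ s = let Γ , c , _ = s ; d , m = postᶜ s in
           ¬ Repeated S eff Γ c ×
           ∃ λ a → ∃ λ e → ⟦ d ⟧ ⟹[ a ] ⟦ e ⟧ × s′ ≡ (extend a (d , m) Γ , e , m)

  plan-mono : ∀ {f f′} → f ℕ.≤ f′ → ∀ Γ c n → Is-just (plan S eff f Γ c n) → Is-just (plan S eff f′ Γ c n)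
  childPlan-mono : ∀ {f f′} → f ℕ.≤ f′ → ∀ Γ n {c a} (x : Successor S eff c a) →
                   Is-just (childPlan S eff f Γ n x) → Is-just (childPlan S eff f′ Γ n x)
  plan-mono (s≤s f≤f′) Γ c n j with repeated? S eff Γ c
  ... | yes _ = just _
  ... | no _  = is-just-map⁺ (allJust⁺ _ λ a →
    childPlan-mono f≤f′ _ _ (successor _ a) (allJust⁻ _ (is-just-map⁻ j) a))
  childPlan-mono f≤f′ Γ n (inj₁ (d , _)) j = is-just-map⁺ (plan-mono f≤f′ Γ d n (is-just-map⁻ j))
  childPlan-mono f≤f′ Γ n (inj₂ _)       j = just _

  plan-suc : ∀ fuel Γ c n → let d , m = post S eff Γ c n in
    (¬ Repeated S eff Γ c → ∀ a →
      Is-just (childPlan S eff fuel (extend a (d , m) Γ) m (successor d a))) →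
    Is-just (plan S eff (suc fuel) Γ c n)
  plan-suc fuel Γ c n js with repeated? S eff Γ c
  ... | yes _ = just _
  ... | no ¬r = is-just-map⁺ (allJust⁺ _ (js ¬r))

  -- The finitely many children may need different amounts of fuel; `plan-mono` raises them to a
  -- common bound, and the node itself takes one more.
  acc⇒plan : ∀ Γ c n → Acc _◁_ (Γ , c , n) → ∃ λ fuel → Is-just (plan S eff fuel Γ c n)
  acc⇒plan Γ c n (acc rs) with repeated? S eff Γ c
  ... | yes r = 1 , plan-suc 0 Γ c n (contradiction r)
  ... | no ¬r = suc (proj₁ fuel) , plan-suc (proj₁ fuel) Γ c n λ _ a →
      childPlan-mono (proj₂ fuel a) _ m (successor d a) (proj₂ (below a (successor d a)))
    where
    d = proj₁ (post S eff Γ c n)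
    m = proj₂ (post S eff Γ c n)
    below : ∀ a (x : Successor S eff d a) →
            ∃ λ f → Is-just (childPlan S eff f (extend a (d , m) Γ) m x)
    below a (inj₁ (e , d⟹e)) =
      let f , j = acc⇒plan _ e m (rs (¬r , a , e , d⟹e , refl)) in f , is-just-map⁺ j
    below a (inj₂ _) = 0 , just _
    fuel : ∃ λ N → ∀ a → proj₁ (below a (successor d a)) ℕ.≤ N
    fuel = bounded λ a → proj₁ (below a (successor d a))

  module _ (em : ExcludedMiddle (lsuc 0ℓ)) (very : IsVeryWSTS S) where
    open IsVeryWSTS very

    -- An entry with the current acceleration count is separated from the current
    -- node by no acceleration, so its ideal evolves into the current one.
    Consistent : Codes S eff → Code → ℕ → Set₁
    Consistent Γ c n = ∀ {a w d m} → (a , w , d , m) ∈ˡ Γ →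
      m ℕ.≤ n × (m ≡ n → Path (completion S) ⟦ d ⟧ (a ∷ w) ⟦ c ⟧)

    Invariant : Config → Set₁
    Invariant (Γ , c , n) = Consistent Γ c n × Idl S n ⟦ c ⟧

    -- An ancestor with the same count leads to c by a path of the completion, so strict domination
    -- implies growth. The acceleration is therefore a genuine one and climbs a level along with the
    -- count.
    relabel-invariant : ∀ {Γ c n} (dom? : Dec (Dominated S eff Γ c n)) → Consistent Γ c n → Idl S n ⟦ c ⟧ →
      let d , m = relabel S eff dom? in Consistent Γ d m × Idl S m ⟦ d ⟧
    relabel-invariant (no _) con c∈Idl = con , c∈Idl
    relabel-invariant {c = c} {n} (yes dom) con c∈Idl =
      -- All entries have counts at most n, so none equals the new count `suc n` and no path is
      -- owed.
      (λ e∈ → let m≤n , _ = con e∈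
              in ℕ.m≤n⇒m≤1+n m≤n , λ { refl → contradiction m≤n ℕ.1+n≰n }) ,
      accelerated dom con
      where
      accelerated : ∀ {Δ} (dom : Dominated S eff Δ c n) → Consistent Δ c n →
        let a , w , _ = Any.lookup dom in Idl S (suc n) ⟦ proj₁ (power a w c) ⟧
      accelerated (there dom) con = accelerated dom (con ∘ there)
      accelerated (here {x = a , w , d , m} (d⊂c , refl)) con =
        Idl-acceleration S em very n (a ∷ w) ⟦ c ⟧ ⟦ proj₁ (power a w c) ⟧ c∈Idl
          (grows-strict S em very {⟦ d ⟧} {⟦ c ⟧} {⟦ c ⟧} d⊂c (proj₂ (con (here refl)) refl) (id , id))
          (proj₂ (power a w c))

    ◁-invariant : ∀ {s s′} → s′ ◁ s → Invariant s → Invariant s′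
    ◁-invariant {Γ , c , n} (_ , a , e , d⟹e , refl) (con , c∈Idl)
      with post S eff Γ c n | relabel-invariant (dominated? S eff Γ c n) con c∈Idl
    ... | d , m | con′ , d∈Idl =
      (λ { (here refl) → ℕ.≤-refl , λ _ → d⟹e ∷ []
         ; (there e∈)  → extended e∈ }) ,
      Idl-⟹ S em very m ⟦ d ⟧ ⟦ e ⟧ d∈Idl d⟹e
      where
      extended : ∀ {b w l} → (b , w , l) ∈ˡ map _ Γ → proj₂ l ℕ.≤ m ×
                 (proj₂ l ≡ m → Path (completion S) ⟦ proj₁ l ⟧ (b ∷ w) ⟦ e ⟧)
      extended e∈ with ∈-map⁻ _ e∈
      ... | _ , e∈Γ , refl = let m′≤m , π = con′ e∈Γ
                             in m′≤m , λ eq → path-++ (completion S) (π eq) (d⟹e ∷ [])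

    -- Contrapositively, once a level is empty all higher ones are; this turns finitely many levels
    -- into a bound on counts.
    Idl-inhabited : ∀ {m n I} → m ≤′ n → Idl S n I → ∃ λ J → Idl S m J
    Idl-inhabited ≤′-refl       I∈                   = _ , I∈
    Idl-inhabited (≤′-step m≤n) (f , _ , f∈Idl , _) = Idl-inhabited m≤n (f∈Idl 0)

    relabel-same : ∀ {Γ c n} (dom? : Dec (Dominated S eff Γ c n)) → proj₂ (relabel S eff dom?) ≡ n →
                   proj₁ (relabel S eff dom?) ≡ c × ¬ Dominated S eff Γ c n
    relabel-same (no ¬dom) _ = refl , ¬dom
    relabel-same (yes _)   p = contradiction p ℕ.1+n≢n

    relabel-≥ : ∀ {Γ c n} (dom? : Dec (Dominated S eff Γ c n)) → n ℕ.≤ proj₂ (relabel S eff dom?)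
    relabel-≥ (no _)  = ℕ.≤-refl
    relabel-≥ (yes _) = ℕ.n≤1+n _

    module _ (c : Code) (f : ℕ → Config) (f0 : f 0 ≡ ([] , c , 0)) (f◁ : ∀ i → f (suc i) ◁ f i) where

      private
        invariant : ∀ i → Invariant (f i)
        invariant zero    = subst Invariant (sym f0) ((λ ()) , tt)
        invariant (suc i) = ◁-invariant (f◁ i) (invariant i)

        ideals : ℕ → Ideal S
        ideals i = ⟦ proj₁ (postᶜ (f i)) ⟧

        level : ℕ → ℕ
        level i = proj₂ (postᶜ (f i))

        created : ∀ i → proj₂ (proj₂ (f (suc i))) ≡ level i
        created i = let _ , _ , _ , _ , eq = f◁ i in cong (proj₂ ∘ proj₂) eq

        level↑ : ∀ i → level i ℕ.≤ level (suc i)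
        level↑ i = let Γ , d , n = f (suc i) in
          subst (ℕ._≤ level (suc i)) (created i) (relabel-≥ (dominated? S eff Γ d n))

        level-bounded : ∀ i → level i < proj₁ finitelyManyLevels
        level-bounded i = ℕ.≰⇒> λ N≤ →
          let con , ∈Idl = invariant i
              J , J∈Idl  = Idl-inhabited (ℕ.≤⇒≤′ N≤)
                             (proj₂ (relabel-invariant (dominated? S eff _ _ _) con ∈Idl))
          in proj₂ finitelyManyLevels J J∈Idl

        entry : ∀ {i j} → suc i ≤′ j → ∃ λ a → ∃ λ w → (a , w , postᶜ (f i)) ∈ˡ proj₁ (f j)
        entry {i} ≤′-refl = let _ , a , _ , _ , eq = f◁ i
                            in a , [] , subst ((a , [] , postᶜ (f i)) ∈ˡ_) (sym (cong proj₁ eq)) (here refl)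
        entry {i} (≤′-step {j} i<j) =
          let b , w , e∈           = entry i<j
              _ , a , _ , _ , eq = f◁ j
          in b , w ++ [ a ] ,
             subst ((b , w ++ [ a ] , postᶜ (f i)) ∈ˡ_) (sym (cong proj₁ eq)) (there (∈-map⁺ _ e∈))

      no-infinite-branch : ⊥
      no-infinite-branch =
        let N , const = eventually-constant (lowerEM em) level level↑ level-bounded
        in collide N const (IsWSTS.wqo completionIsWSTS (λ i → ideals (i + N)))
        where
        collide : ∀ N → (∀ i → level (i + N) ≡ level N) →
                  (∃ λ i → ∃ λ j → i < j × set (ideals (i + N)) ⊆ set (ideals (j + N))) → ⊥
        collide N const (i , suc j , i<j , i⊆j) =
          let Γ , d , n        = f (suc j + N)
              -- This node is created with the count of its parent, and processing leaves that count
              -- unchanged. So it was not accelerated: its ideal is unchanged and nothing dominates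
              -- it.
              level≡n          = trans (const (suc j)) (trans (sym (const j)) (sym (created (j + N))))
              same , ¬dom      = relabel-same (dominated? S eff Γ d n) level≡n
              ¬rep , _         = f◁ (suc j + N)
              a , w , e∈       = entry (ℕ.≤⇒≤′ (ℕ.+-monoˡ-≤ N i<j))
              i⊆d              = subst (λ e → set (ideals (i + N)) ⊆ set ⟦ e ⟧) same i⊆j
              leveli≡n         = trans (const i) (trans (sym (const (suc j))) level≡n)
          -- The inclusion is strict, since the reverse one would make the node a repetition, and
          -- closed nodes have no children.
          in ¬dom (lose e∈ ((i⊆d , λ d⊆i → ¬rep (lose e∈ (i⊆d , d⊆i))) , leveli≡n))

    plan-exists : ∀ c → ∃ λ fuel → Is-just (plan S eff fuel [] c 0)
    plan-exists c = acc⇒plan [] c 0 (noDescent⇒acc em ([] , c , 0) (no-infinite-branch c))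

-- The finite automaton

module _ {k} (S : TransitionSystem k 0ℓ 0ℓ 0ℓ) where

  Located : Tree S → Set₁
  Located t = ∃ λ u → ∃ λ s → At S t u s

  -- The child is passed to `nodesBelow` together with its equation, so that matching on it still
  -- leaves the proof that `there` requires.
  nodes         : (t : Tree S) → List (Located t)
  nodesBelow    : ∀ t a x → Tree.child t a ≡ x → List (Located t)
  nodes t@(node _ _ _ _ kids) = ([] , t , here) ∷ concatMap (λ a → nodesBelow t a (kids a) refl) (allFin k)
  nodesBelow t a nothing  eq = []
  nodesBelow t a (just s) eq = map (λ { (u , r , o) → a ∷ u , r , there eq o }) (nodes s)

  -- Nodes are compared by address alone; `node-ideal` recovers equality of ideals from it.
  nodes-complete : ∀ {t u s} → At S t u s → Any (λ c → proj₁ c ≡ u) (nodes t)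
  nodesBelow-complete : ∀ t {a u s r} x (eq : Tree.child t a ≡ x) → x ≡ just s → At S s u r →
                        Any (λ c → proj₁ c ≡ a ∷ u) (nodesBelow t a x eq)
  nodes-complete {node _ _ _ _ _} here = here refl
  nodes-complete {t@(node _ _ _ _ kids)} (there {a} eq o) =
    there (Any.concatMap⁺ (λ a → nodesBelow t a (kids a) refl)
      (lose (∈-allFin a) (nodesBelow-complete t (kids a) refl eq o)))
  nodesBelow-complete t (just s) eq refl o = Any.map⁺ (Any.map (cong (_ ∷_)) (nodes-complete o))

module _ {k} (S : TransitionSystem k 0ℓ 0ℓ 0ℓ) (eff : Effective S) {t : Tree S} (dn : Done S eff t) where
  open Effective eff
  open Ideal
  open Node

  Index : Set
  Index = Fin (length (nodes S t))

  private
    at-index : (i : Index) → At S t _ _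
    at-index i = proj₂ (proj₂ (lookup (nodes S t) i))

  nodeOfIndex : Index → Node S t
  nodeOfIndex i = nodeOf S (at-index i)

  code : Index → Code
  code i = proj₁ (proj₂ (done-at S eff dn (at-index i)))

  ideal≡code : ∀ i → ideal (nodeOfIndex i) ≡ ⟦ code i ⟧
  ideal≡code i = proj₂ (proj₂ (done-at S eff dn (at-index i)))

  index : ∀ {u s} → At S t u s → Index
  index o = Any.index (nodes-complete S o)

  address-index : ∀ {u s} (o : At S t u s) → u ≡ address (nodeOfIndex (index o))
  address-index o = sym (Any.lookup-index (nodes-complete S o))

  Arc : Fin k → Index → Index → Set
  Arc a i j = Descends S (nodeOfIndex i) [ a ] (nodeOfIndex j)

  arc? : ∀ a i j → Dec (Arc a i j)
  arc? a i j = ≡-dec _≟_ _ _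

  -- Besides skipping letters, which closes the language under subwords, the
  -- ε-transitions comprise those of the stuttering automaton, being inclusions.
  Silent : Index → Index → Set
  Silent i j = (∃ λ a → Arc a i j) ⊎ (set ⟦ code j ⟧ ⊆ set ⟦ code i ⟧)

  silent? : ∀ i j → Dec (Silent i j)
  silent? i j = Fin.any? (λ a → arc? a i j) ⊎-dec inclusion? (code j) (code i)

  downAutomaton : FiniteAutomaton k
  downAutomaton = record
    { size      = length (nodes S t)
    ; initial   = index here
    ; accepting = λ _ → true
    ; move      = λ { i (just a) j → ⌊ arc? a i j ⌋ ; i nothing j → ⌊ silent? i j ⌋ }
    }

  private F = automaton downAutomaton

  silent-move : ∀ {i j} → Silent i j → Automaton.move F i nothing j
  silent-move {i} {j} = fromWitness {a? = silent? i j}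

  node-ideal : ∀ (c d : Node S t) → address c ≡ address d → ideal c ≡ ideal d
  node-ideal c d c≡d with at-suffix S (nodeAt S c) (nodeAt S d) (trans (++-identityʳ _) c≡d)
  ... | here = refl

  ⊆-resp : ∀ {I I′ J J′ : Ideal S} → I ≡ I′ → J ≡ J′ → set I ⊆ set J → set I′ ⊆ set J′
  ⊆-resp refl refl I⊆J = I⊆J

  run-≼ : ∀ {i u v j} → u ≼ v → Run F i v j → Run F i u j
  run-≼ []         done         = done
  run-≼ u≼v        (silent e r) = silent e (run-≼ u≼v r)
  run-≼ (refl ∷ τ) (read e r)   = read e (run-≼ τ r)
  -- A dropped letter is skipped by taking its arc silently.
  run-≼ {i} (a ∷ʳ τ) (read {q = j} e r) =
    silent {q = j} (silent-move {i} {j} (inj₁ (a , toWitness {a? = arc? a i j} e))) (run-≼ τ r)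

  run-stuttering : ∀ {c w d} → Run (𝒜 S t) c w d → ∀ i → address c ≡ address (nodeOfIndex i) →
                   ∃ λ j → Run F i w j
  run-stuttering done i _ = i , done
  run-stuttering (read {q = d} (arc c→d) r) i refl =
    let j     = index (nodeAt S d)
        d≡j   = address-index (nodeAt S d)
        l , ρ = run-stuttering r j d≡j
    in l , read {q = j} (fromWitness {a? = arc? _ i j} (trans c→d d≡j)) ρ
  run-stuttering {c} (silent {q = c′} (loop _ _ (_ , c′⊆c)) r) i c≡i =
    let j     = index (nodeAt S c′)
        c′≡j  = address-index (nodeAt S c′)
        l , ρ = run-stuttering r j c′≡j
        j⊆i   = ⊆-resp
          (trans (node-ideal c′ (nodeOfIndex j) c′≡j) (ideal≡code j))
          (trans (node-ideal c (nodeOfIndex i) c≡i) (ideal≡code i)) c′⊆c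
    in l , silent {q = j} (silent-move {i} {j} (inj₂ j⊆i)) ρ

  module _ (em : ExcludedMiddle (lsuc 0ℓ)) (very : IsVeryWSTS S) {I} (reachable : Reachable S I t) where

    finished : ∀ c → marked c ≡ true
    finished c = proj₁ (done-at S eff dn (nodeAt S c))

    private
      lab : Index → Pred _ 0ℓ
      lab i = set (ideal (nodeOfIndex i))

      move-covers′ : ∀ {i α j} → Automaton.move F i α j → Covers S (lab i) (fromMaybe α) (lab j)
      move-covers′ {i} {just a} {j} e =
        arc-covers S em very reachable (nodeOfIndex i) (nodeOfIndex j)
          (toWitness {a? = arc? a i j} e)
      move-covers′ {i} {nothing} {j} e with toWitness {a? = silent? i j} e
      ... | inj₁ (a , i→j) = covers-weaken S {lab i} {lab j} (minimum _)
              (arc-covers S em very reachable (nodeOfIndex i) (nodeOfIndex j) i→j)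
      ... | inj₂ j⊆i = ⊇⇒covers S (⊆-resp (sym (ideal≡code j)) (sym (ideal≡code i)) j⊆i)

      initial-⊆ : lab (index here) ⊆ set I
      initial-⊆ = ⊆-resp {J = I} (node-ideal (root S t) (nodeOfIndex (index here)) (address-index here)) refl
                    (root-⊆ S em very reachable)

    -- Every transition is sound for covering, which already allows for skipped letters. Conversely
    -- a trace runs in the stuttering automaton, that run is transferred, and `run-≼` drops letters.
    downAutomaton-recognizes : downAutomaton Recognizes ↓≼ (Tracesˢ S (set I))
    downAutomaton-recognizes =
      (λ { (j , r , _) →
         let q , q∈ = nonempty (ideal (nodeOfIndex j))
             p , v , s , p∈ , u≼v , π , _ =
               run-covers S (IsVeryWSTS.stronglyMonotone very) F lab
                 (λ {i} {α} {j} → move-covers′ {i} {α} {j}) r q∈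
         in v , u≼v , p , initial-⊆ p∈ , s , π }) ,
      (λ { (v , u≼v , tr) →
         let _ , r , _ = traces-⊆ S em very reachable finished tr
             j , r′    = run-stuttering r (index here) (address-index here)
         in j , run-≼ u≼v r′ , Unit.tt })

-- Computability

to-witness-just : ∀ {a} {A : Set a} {x : Maybe A} (j : Is-just x) → x ≡ just (to-witness j)
to-witness-just (just _) = refl

map-just⁻ : ∀ {a b} {A : Set a} {B : Set b} {f : A → B} x {y} → Maybe.map f x ≡ just y → ∃ λ z → f z ≡ y
map-just⁻ (just z) refl = z , refl

module _ {k} (S : TransitionSystem k 0ℓ 0ℓ 0ℓ) (eff : Effective S) where
  open Effective eff
  open Ideal

  output : ∀ {c} → Plan S eff [] c 0 → ∃ λ t → Reachable S ⟦ c ⟧ t × Done S eff t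
  output p with execute S eff p start here refl
  ... | t , reachable , _ , here , _ , dn = t , reachable , dn

  planAutomaton : ∀ {c} → Plan S eff [] c 0 → FiniteAutomaton k
  planAutomaton p = downAutomaton S eff (proj₂ (proj₂ (output p)))

  tracesAutomaton : TransitionSystem.Carrier S → Computation (FiniteAutomaton k)
  tracesAutomaton p fuel = Maybe.map planAutomaton (plan S eff fuel [] (proj₁ (down p)) 0)

  module _ (em : ExcludedMiddle (lsuc 0ℓ)) (very : IsVeryWSTS S) where

    returns : ∀ c → ∃ λ t → Returns S ⟦ c ⟧ t
    returns c =
      let t , reachable , dn = output (to-witness (proj₂ (plan-exists S eff em very c)))
      in t , reachable , finished S eff dn em very reachable

-- Classical effectiveness

module _ {k} (S : TransitionSystem k 0ℓ 0ℓ 0ℓ) (em : ExcludedMiddle (lsuc 0ℓ)) (very : IsVeryWSTS S)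
         (I : Ideal S) where
  open TransitionSystem S using () renaming (Carrier to X)
  open TransitionSystem (completion S) using () renaming (_⟶[_]_ to _⟹[_]_)
  open Ideal

  -- Ideals do not form a small type, so codes are terms for the ideals that the
  -- operations of the algorithm generate.
  data Term : Set where
    base      : Term
    below     : X → Term
    successor : Fin k → Term → Term
    power     : Fin k → Word k → Term → Term

  private
    pick : ∀ J {a} → Dec (∃ λ K → J ⟹[ a ] K) → Ideal S
    pick J (yes (K , _)) = K
    -- A default value for a disabled letter; `pick-correct` then certifies that no successor
    -- exists.
    pick J (no _)        = J

    pick-correct : ∀ J {a} (d : Dec (∃ λ K → J ⟹[ a ] K)) →
                   (J ⟹[ a ] pick J d) ⊎ (∀ K → ¬ (J ⟹[ a ] K))
    pick-correct J (yes (_ , J⟹K)) = inj₁ J⟹K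
    pick-correct J (no disabled)   = inj₂ λ K J⟹K → disabled (K , J⟹K)

  evaluate : Term → Ideal S
  evaluate base            = I
  evaluate (below p)       = principal S p
  evaluate (successor a c) = pick (evaluate c) {a} em
  evaluate (power a w c)   = proj₁ (acceleration S em very (a ∷ w) (evaluate c))

  classicallyEffective : Effective S
  classicallyEffective = record
    { Code       = Term
    ; ⟦_⟧        = evaluate
    ; down       = λ p → below p , id , id
    ; inclusion? = λ c d → lowerEM em
    ; successor  = λ c a → Sum.map₁ (successor a c ,_) (pick-correct (evaluate c) em)
    ; power      = λ a w c → power a w c , proj₂ (acceleration S em very (a ∷ w) (evaluate c))
    }

-- Principal ideals and correctness of the procedure

module _ {k} (S : TransitionSystem k 0ℓ 0ℓ 0ℓ) where

  stuttering-run : ∀ {t c w d} → Run (𝒜 S t) c w d → Run (𝒦 S t) c w d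
  stuttering-run done                 = done
  stuttering-run (read {q = d} e r)   = read {q = d} (stuttering e) (stuttering-run r)
  stuttering-run (silent {q = d} e r) = silent {q = d} (stuttering e) (stuttering-run r)

  module _ (em : ExcludedMiddle (lsuc 0ℓ)) (very : IsVeryWSTS S) (x : TransitionSystem.Carrier S) where
    open Ideal
    open IsVeryWSTS very
    open IsPreorder (TransitionSystem.isQuasiOrder S) renaming (refl to ⊑-refl; trans to ⊑-trans)

    ↓Post*-principal : ↓ S (Post*ˢ S (set (principal S x))) ≐ ↓ S (Post* S x)
    ↓Post*-principal =
      (λ { (s , q⊑s , p , p⊑x , w , π) →
         let s′ , π′ , s⊑s′ = path-mono S stronglyMonotone π p⊑x
         in s′ , ⊑-trans q⊑s s⊑s′ , w , π′ }) ,
      (λ { (s , q⊑s , reach) → s , q⊑s , x , ⊑-refl , reach })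

    traces-principal : Tracesˢ S (set (principal S x)) ≐ Traces S x
    traces-principal =
      (λ { (p , p⊑x , q , π) →
         let q′ , π′ , _ = path-mono S stronglyMonotone π p⊑x in q′ , π′ }) ,
      (λ { (q , π) → x , ⊑-refl , q , π })

    -- The code of ↓x denotes an ideal equal to `principal S x` only extensionally, so traces are
    -- transferred by membership in both directions.
    tracesAutomaton-correct : ∀ eff → tracesAutomaton S eff x Computes (_Recognizes ↓≼ (Traces S x))
    tracesAutomaton-correct eff = terminates , correct
      where
      open Effective eff
      c = proj₁ (down x)

      recognizes : (p : Plan S eff [] c 0) → planAutomaton S eff p Recognizes ↓≼ (Traces S x)
      recognizes p =
        let t , reachable , dn = output S eff p
            L⊆ , ⊆L            = downAutomaton-recognizes S eff dn em very reachable
            ⟦c⟧⊆ , ⊆⟦c⟧        = proj₂ (down x)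
        in (λ u∈L → let v , u≼v , p , p∈ , tr = L⊆ u∈L
                    in v , u≼v , proj₁ traces-principal (p , ⟦c⟧⊆ p∈ , tr)) ,
           (λ { (v , u≼v , tr) → ⊆L (v , u≼v , x , ⊆⟦c⟧ ⊑-refl , tr) })

      terminates : ∃ λ fuel → ∃ λ F → tracesAutomaton S eff x fuel ≡ just F
      terminates =
        let fuel , j = plan-exists S eff em very c
        in fuel , planAutomaton S eff (to-witness j) , cong (Maybe.map (planAutomaton S eff)) (to-witness-just j)

      correct : ∀ fuel F → tracesAutomaton S eff x fuel ≡ just F → F Recognizes ↓≼ (Traces S x)
      correct fuel F eq =
        let p , p↦F = map-just⁻ (plan S eff fuel [] c 0) eq
        in subst (_Recognizes ↓≼ (Traces S x)) p↦F (recognizes p)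

theorem10 :
  ∀ {k : ℕ} (S : TransitionSystem k 0ℓ 0ℓ 0ℓ) →
  let open TransitionSystem S using (Carrier) in
  let open Ideal using (set) in
  -- The procedure is produced without access to excluded middle, which is
  -- only available for proving its correctness and the other claims.
  Σ (Effective S → Carrier → Computation (FiniteAutomaton k)) λ procedure →
    ExcludedMiddle (lsuc 0ℓ) → IsVeryWSTS S →
    (∀ (I : Ideal S) →
      (∃ λ t → Returns S I t) ×
      (∀ t → Returns S I t →
        (D S t ≐ ↓ S (Post*ˢ S (set I))) ×
        (Tracesˢ S (set I) ⊆ L (𝒜 S t)) ×
        (L (𝒦 S t) ⊆ ↓≼ (Tracesˢ S (set I))))) ×
    (∀ (x : Carrier) →
      (∀ t → Returns S (principal S x) t →
        (D S t ≐ ↓ S (Post* S x)) ×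
        (↓≼ (L (𝒦 S t)) ≐ ↓≼ (Traces S x))) ×
      Regular (↓≼ (Traces S x)) ×
      (∀ (eff : Effective S) →
        procedure eff x Computes (_Recognizes ↓≼ (Traces S x))))
theorem10 S = tracesAutomaton S , λ em very →
  (λ I → returns S (classicallyEffective S em very I) em very base , λ t (reachable , finished) →
    D≐↓Post* S em very reachable finished ,
    traces-⊆ S em very reachable finished ,
    L𝒦-⊆ S em very reachable) ,
  λ x →
    (λ t (reachable , finished) →
      ≐-trans (D≐↓Post* S em very reachable finished) (↓Post*-principal S em very x) ,
      (λ { (v , u≼v , v∈L) →
         let w , v≼w , w∈T = L𝒦-⊆ S em very reachable v∈L
         in w , ⊆-trans u≼v v≼w , proj₁ (traces-principal S em very x) w∈T }) ,
      (λ { (v , u≼v , v∈T) →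
         let d , r , _ = traces-⊆ S em very reachable finished (proj₂ (traces-principal S em very x) v∈T)
         in v , u≼v , d , stuttering-run S {c = root S t} {d = d} r , tt })) ,
    -- Regularity comes from running the same procedure on the classical codes, where its
    -- termination yields an automaton.
    (let (fuel , F , eq) , recognizes =
           tracesAutomaton-correct S em very x (classicallyEffective S em very (principal S x))
     in F , recognizes fuel F eq) ,
    tracesAutomaton-correct S em very x
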